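{- Let $G$ be an embedded graph, and for $A\subseteq E(G)$ let $G^{\delta(A)}$ be its partial dual with respect to $A$. (1) One has $$(-1)^{r(G)}\lambda^{c(G)}R(G;1-\lambda,-\lambda,1/\lambda)=\sum_{A\subseteq E(G)}(-1)^{|A|}\chi\big((G^{\delta(A)})^{\times};\lambda\big).$$ (2) If $G$ is a plane graph, then $$(-1)^{r(G)}(1-x)^{c(G)}T(G;x,x)=\sum_{A\subseteq E(G)}(-1)^{|A|}\chi\big((G^{\delta(A)})^{\times};1-x\big).$$
   Context: An embedded graph is a graph (loops and multiple edges allowed, not necessarily connected) cellularly embedded in a closed, possibly non-orientable, surface. Equivalently, it is a ribbon graph: a surface with boundary written as a union of vertex discs and edge discs (ribbons), each edge disc meeting the vertex discs in exactly two disjoint arcs. Equivalently, it is given by an arrow presentation: a set of circles carrying disjoint labelled arrows (marking arrows), exactly two with each label. The ribbon graph described by an arrow presentation has a vertex disc bounded by each circle, and for each label $e$ an edge disc with oriented boundary, attached along the two $e$-labelled arrows so that the directions of the arrows agree with the orientation of the boundary of the edge disc. Arrow presentations are considered up to describing the same ribbon graph. $c(G)$ is the number of connected components, $r(G)=|V(G)|-c(G)$, $n(G)=|E(G)|-r(G)$, and $f(G)$ is the number of boundary components of the ribbon graph. For $A\subseteq E(G)$, $c(A),r(A),n(A),f(A)$ refer to the spanning ribbon subgraph $(V(G),A)$. $G$ is plane if it is connected and has Euler genus $0$. Partial dual: $G^{\delta(A)}$ is obtained from an arrow presentation of $G$ by doing the following for each $e\in A$. If $\alpha,\beta$ are the two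 $e$-labelled arrows, draw a line segment carrying an arrow directed from the tip of $\alpha$ to the tail of $\beta$ and a line segment carrying an arrow directed from the tip of $\beta$ to the tail of $\alpha$; label both new arrows $e$; delete $\alpha$, $\beta$ and the arcs of circles on which they lie. (So $G^{\delta(E(G))}=G^*$ is the geometric dual.) The Petrie dual $G^{\times}$ is obtained by reversing exactly one of the two $e$-labelled arrows for every edge $e$ (i.e. adding a half-twist to every edge). Ribbon graph (Bollobás–Riordan) polynomial: $R(G;x,y,z)=\sum_{A\subseteq E(G)}(x-1)^{r(G)-r(A)}y^{n(A)}z^{c(A)-f(A)+n(A)}$. Tutte polynomial: $T(G;x,y)=\sum_{A\subseteq E(G)}(x-1)^{r(G)-r(A)}(y-1)^{n(A)}$. $\chi(H;\lambda)$ is the chromatic polynomial of the underlying abstract graph of $H$ (it is $0$ if $H$ has a loop). -}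

module Defs where

open import Level using (0ℓ)
open import Algebra.Bundles using (CommutativeRing)
import Algebra.Properties.Semiring.Exp as Exp
import Algebra.Definitions.RawMonoid as Multiple
open import Data.Bool.Base using (true; false; if_then_else_)
open import Data.Empty using (⊥-elim)
open import Data.Fin.Base
  using (Fin; zero; suc; punchIn; punchOut; combine; finToFun; funToFin)
open import Data.Fin.Patterns using (0F; 1F; 2F; 3F)
import Data.Fin.Properties as Fin
open import Data.Fin.Subset using (Subset; ⊤; ⊥; ∣_∣; inside; outside)
open import Data.Integer.Base as ℤ using (ℤ; +_; -[1+_])
import Data.Integer.Properties as ℤ
open import Data.Integer.Solver using (module +-*-Solver)
open import Data.List.Base as List using (List; []; _∷_; length; filter; allFin)
open import Data.List.Membership.Propositional using (_∈_)
open import Data.List.Membership.Propositional.Properties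
  using (∈-allFin; ∈-map⁺; ∈-map⁻; ∈-filter⁺; ∈-filter⁻
        ; ∈-cartesianProductWith⁺; ∈-cartesianProductWith⁻)
open import Data.List.Membership.Propositional.Properties.WithK
  using (unique∧set⇒bag)
open import Data.List.Properties using (length-map; length-tabulate; filter-all)
open import Data.List.Relation.Binary.BagAndSetEquality using (∼bag⇒↭)
open import Data.List.Relation.Binary.Permutation.Propositional.Properties
  using (↭-length)
import Data.List.Relation.Unary.All as All
open import Data.List.Relation.Unary.Any using (here; there)
open import Data.List.Relation.Unary.Unique.Propositional.Properties
  using (map⁺; filter⁺; allFin⁺)
open import Data.Nat.Base as ℕ using (ℕ; zero; suc; _∸_)
open import Data.Nat.Properties using (+-suc)
open import Data.Product.Base using (∃; _×_; _,_; proj₁; proj₂)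
open import Data.Product.Function.NonDependent.Propositional using (_×-↔_)
open import Data.Sum.Base using (_⊎_; inj₁; inj₂; map₁)
open import Data.Sum.Function.Propositional using (_⊎-↔_)
open import Data.Vec.Base using (Vec; []; _∷_; lookup)
open import Function.Base using (_∘_; id)
open import Function.Bundles
  using (_↔_; _⇔_; Inverse; Equivalence; mk↔ₛ′; mk⇔)
open import Function.Construct.Composition using (_↔-∘_)
open import Function.Construct.Identity using (↔-id)
open import Function.Construct.Symmetry using (↔-sym)
open import Function.Definitions using (StrictlySurjective)
open import Relation.Binary.Construct.Closure.Equivalence as EqC
  using (EqClosure)
import Relation.Binary.Construct.On as On
open import Relation.Binary.Core using (Rel)
open import Relation.Binary.PropositionalEquality
  using (_≡_; _≢_; refl; sym; trans; cong; cong₂; subst; ≢-sym; isEquivalence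
        ; module ≡-Reasoning)
open import Relation.Nullary using (¬_; Dec; yes; no; ¬?; _×-dec_)

------------------------------------------------------------------------
-- Identifying two elements of a finite set

module _ {m : ℕ} {u v : Fin (suc m)} (u≢v : u ≢ v) where

  merge : Fin (suc m) → Fin m
  merge x with x Fin.≟ v
  ... | yes _  = punchOut (≢-sym u≢v)
  ... | no x≢v = punchOut (≢-sym x≢v)

  punchIn-merge : ∀ x → (x ≡ v × punchIn v (merge x) ≡ u)
                      ⊎ punchIn v (merge x) ≡ x
  punchIn-merge x with x Fin.≟ v
  ... | yes x≡v = inj₁ (x≡v , Fin.punchIn-punchOut (≢-sym u≢v))
  ... | no x≢v  = inj₂ (Fin.punchIn-punchOut (≢-sym x≢v))

  merge-punchIn : ∀ y → merge (punchIn v y) ≡ y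
  merge-punchIn y with punchIn-merge (punchIn v y)
  ... | inj₁ (v∈ , _) = ⊥-elim (Fin.punchInᵢ≢i v y v∈)
  ... | inj₂ eq       = Fin.punchIn-injective v _ _ eq

  merge-identifies : merge u ≡ merge v
  merge-identifies with punchIn-merge u | punchIn-merge v
  ... | inj₁ (u≡v , _) | _             = ⊥-elim (u≢v u≡v)
  ... | inj₂ p         | inj₁ (_ , q)  =
    Fin.punchIn-injective v _ _ (trans p (sym q))
  ... | inj₂ _         | inj₂ q        = ⊥-elim (Fin.punchInᵢ≢i v _ q)

  -- Only u and v are identified.
  merge-kernel : ∀ {ℓ} (P : Rel (Fin (suc m)) ℓ) →
                 (∀ {x} → P x x) → P u v → P v u →
                 ∀ x y → merge x ≡ merge y → P x y
  merge-kernel P rfl uv vu x y eq with punchIn-merge x | punchIn-merge y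
  ... | inj₁ (refl , _) | inj₁ (refl , _) = rfl
  ... | inj₁ (refl , p) | inj₂ q
    with refl ← trans (sym p) (trans (cong (punchIn v) eq) q) = vu
  ... | inj₂ p | inj₁ (refl , q)
    with refl ← trans (sym p) (trans (cong (punchIn v) eq) q) = uv
  ... | inj₂ p | inj₂ q
    with refl ← trans (sym p) (trans (cong (punchIn v) eq) q) = rfl

------------------------------------------------------------------------
-- Equivalence classes of the relation generated by a given one

record Classes {A : Set} (_~_ : Rel A 0ℓ) : Set where
  field
    count      : ℕ
    class      : A → Fin count
    surjective : StrictlySurjective _≡_ class
    class-≡    : ∀ x y → class x ≡ class y ⇔ EqClosure _~_ x y

module _ {A : Set} where

  Listed : List (A × A) → Rel A 0ℓ
  Listed ps x y = (x , y) ∈ ps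

  private
    respects : ∀ {m} {_~_ : Rel A 0ℓ} (h : A → Fin m) →
               (∀ {x y} → x ~ y → h x ≡ h y) →
               ∀ {x y} → EqClosure _~_ x y → h x ≡ h y
    respects h resp = EqC.gfold isEquivalence h resp

    extend : ∀ {ps} u v → Classes (Listed ps) → Classes (Listed ((u , v) ∷ ps))
    extend {ps} u v C with Classes.count C | Classes.class C
                         | Classes.surjective C | Classes.class-≡ C
    ... | count | class | surj | class-≡ with class u Fin.≟ class v
    ... | yes u~v = record
      { count = count ; class = class ; surjective = surj
      ; class-≡ = λ x y → mk⇔
          (EqC.map there ∘ Equivalence.to (class-≡ x y))
          (respects class λ
            { (here refl) → u~v
            ; (there p)   → Equivalence.from (class-≡ _ _) (EqC.return p) })
      }
    extend {ps} u v C | suc count | class | surj | class-≡ | no u≁v = record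
      { count = count
      ; class = class′
      ; surjective = λ i → let x , eq = surj (punchIn (class v) i) in
          x , trans (cong (merge u≁v) eq) (merge-punchIn u≁v i)
      ; class-≡ = λ x y → mk⇔ (to x y) (respects class′ λ
          { (here refl) → merge-identifies u≁v
          ; (there p)   → cong (merge u≁v)
              (Equivalence.from (class-≡ _ _) (EqC.return p)) })
      }
      where
      _≈_ = EqClosure (Listed ((u , v) ∷ ps))
      class′ = merge u≁v ∘ class
      old : ∀ {x y} → class x ≡ class y → x ≈ y
      old eq = EqC.map there (Equivalence.to (class-≡ _ _) eq)
      P : Rel (Fin (suc count)) 0ℓ
      P i j = ∀ x y → class x ≡ i → class y ≡ j → x ≈ y
      uv : u ≈ v
      uv = EqC.return (here refl)
      _∙_ = EqC.transitive (Listed ((u , v) ∷ ps))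
      to : ∀ x y → class′ x ≡ class′ y → x ≈ y
      to x y eq = merge-kernel u≁v P
        (λ _ _ p q → old (trans p (sym q)))
        (λ _ _ p q → old p ∙ (uv ∙ old (sym q)))
        (λ _ _ p q → old p ∙ (EqC.symmetric _ uv ∙ old (sym q)))
        (class x) (class y) eq x y refl refl
    extend u v C | zero | class | surj | class-≡ | no u≁v = ⊥-elim (Fin.¬Fin0 (class u))

  classesOfList : ∀ {n} → A ↔ Fin n → (ps : List (A × A)) → Classes (Listed ps)
  classesOfList {n} A↔n [] = record
    { count = n
    ; class = to
    ; surjective = λ i → from i , strictlyInverseˡ i
    ; class-≡ = λ x y → mk⇔
        (λ eq → subst (EqClosure _ x)
          (trans (sym (strictlyInverseʳ x))
            (trans (cong from eq) (strictlyInverseʳ y)))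
          (EqC.reflexive _))
        (respects to λ ())
    } where open Inverse A↔n
  classesOfList A↔n ((u , v) ∷ ps) = extend u v (classesOfList A↔n ps)

-- When the moves ms are permutations, the classes of the relation
-- generated by Step ms are the orbits of the group they generate.
Step : {A : Set} → List (A → A) → Rel A 0ℓ
Step ms x y = ∃ λ m → m ∈ ms × y ≡ m x

orbits : {A : Set} {n : ℕ} → A ↔ Fin n → (ms : List (A → A)) → Classes (Step ms)
orbits {A} {n} A↔n ms = record
  { count = count ; class = class ; surjective = surjective
  ; class-≡ = λ x y → mk⇔
      (EqC.map listed⇒step ∘ Equivalence.to (class-≡ x y))
      (Equivalence.from (class-≡ x y) ∘ EqC.map step⇒listed)
  }
  where
  open Inverse A↔n
  points : List A
  points = List.map from (allFin n)
  ps : List (A × A)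
  ps = List.cartesianProductWith (λ m x → x , m x) ms points
  listed⇒step : ∀ {x y} → Listed ps x y → Step ms x y
  listed⇒step p with ∈-cartesianProductWith⁻ _ ms points p
  ... | m , _ , m∈ , _ , refl = m , m∈ , refl
  step⇒listed : ∀ {x y} → Step ms x y → Listed ps x y
  step⇒listed {x} (m , m∈ , refl) =
    ∈-cartesianProductWith⁺ (λ m x → x , m x) m∈
      (subst (_∈ points) (strictlyInverseʳ x) (∈-map⁺ from (∈-allFin (to x))))
  open Classes (classesOfList A↔n ps)

------------------------------------------------------------------------
-- Polynomials with integer coefficients and sums over edge sets

Polynomial : Set
Polynomial = List ℤ   -- constant term first

module Evaluation {a ℓ} (K : CommutativeRing a ℓ) where
  open CommutativeRing K
  open Multiple +-rawMonoid using () renaming (_×_ to _·_)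

  fromℤ : ℤ → Carrier
  fromℤ (+ n)    = n · 1#
  fromℤ -[1+ n ] = - (suc n · 1#)

  eval : Polynomial → Carrier → Carrier
  eval []      x = 0#
  eval (a ∷ p) x = fromℤ a + x * eval p x

  ∑⊆ : (m : ℕ) → (Subset m → Carrier) → Carrier
  ∑⊆ zero    t = t []
  ∑⊆ (suc m) t = ∑⊆ m (t ∘ (outside ∷_)) + ∑⊆ m (t ∘ (inside ∷_))

------------------------------------------------------------------------
-- Abstract graphs and the chromatic polynomial

-- Vertices Fin v, edges Fin e; loops and multiple edges are allowed.
Graph : ℕ → ℕ → Set
Graph v e = Fin e → Fin v × Fin v

module _ {v e : ℕ} (Γ : Graph v e) where

  Proper : ∀ {k} → (Fin v → Fin k) → Set
  Proper κ = ∀ i → κ (proj₁ (Γ i)) ≢ κ (proj₂ (Γ i))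

  proper? : ∀ {k} (κ : Fin v → Fin k) → Dec (Proper κ)
  proper? κ = Fin.all? λ i → ¬? (κ (proj₁ (Γ i)) Fin.≟ κ (proj₂ (Γ i)))

  -- finToFun is a bijection from Fin (k ^ v) to the maps Fin v → Fin k.
  properColourings : ℕ → ℕ
  properColourings k =
    length (filter (λ i → proper? (finToFun {k} {v} i)) (allFin (k ℕ.^ v)))

  IsChromaticPolynomial : Polynomial → Set
  IsChromaticPolynomial p =
    ∀ k → Evaluation.eval ℤ.+-*-commutativeRing p (+ k) ≡ + properColourings k

-- Existence of the chromatic polynomial, by deletion and contraction.
-- It is unique (up to trailing zero coefficients), as its values at all
-- natural numbers are prescribed.
module DeletionContraction where
  open Evaluation ℤ.+-*-commutativeRing using (fromℤ; eval)
  open Multiple (CommutativeRing.+-rawMonoid ℤ.+-*-commutativeRing)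
    using () renaming (_×_ to _·_)

  ·1 : ∀ n → n · (+ 1) ≡ + n
  ·1 zero    = refl
  ·1 (suc n) = cong (ℤ._+_ (+ 1)) (·1 n)

  fromℤ-id : ∀ i → fromℤ i ≡ i
  fromℤ-id (+ n)    = ·1 n
  fromℤ-id -[1+ n ] = cong (λ i → ℤ.- i) (·1 (suc n))

  X^ : ℕ → Polynomial
  X^ zero    = + 1 ∷ []
  X^ (suc n) = + 0 ∷ X^ n

  negate : Polynomial → Polynomial
  negate = List.map (λ i → ℤ.- i)

  _⊖_ : Polynomial → Polynomial → Polynomial
  []      ⊖ q       = negate q
  (a ∷ p) ⊖ []      = a ∷ p
  (a ∷ p) ⊖ (b ∷ q) = (a ℤ.- b) ∷ (p ⊖ q)

  eval-∷ : ∀ a p x → eval (a ∷ p) x ≡ a ℤ.+ x ℤ.* eval p x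
  eval-∷ a p x = cong (ℤ._+ x ℤ.* eval p x) (fromℤ-id a)

  open +-*-Solver using (solve; _:=_; _:+_; _:*_; _:-_; :-_; con)

  eval-negate : ∀ p x → eval (negate p) x ≡ ℤ.- eval p x
  eval-negate []      x = refl
  eval-negate (a ∷ p) x = begin
    eval (negate (a ∷ p)) x            ≡⟨ eval-∷ (ℤ.- a) (negate p) x ⟩
    ℤ.- a ℤ.+ x ℤ.* eval (negate p) x  ≡⟨ cong (λ t → ℤ.- a ℤ.+ x ℤ.* t) (eval-negate p x) ⟩
    ℤ.- a ℤ.+ x ℤ.* (ℤ.- eval p x)     ≡⟨ solve 3 (λ a x P → (:- a) :+ x :* (:- P) := :- (a :+ x :* P)) refl a x (eval p x) ⟩
    ℤ.- (a ℤ.+ x ℤ.* eval p x)         ≡⟨ cong (λ i → ℤ.- i) (eval-∷ a p x) ⟨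
    ℤ.- eval (a ∷ p) x                 ∎
    where open ≡-Reasoning

  eval-⊖ : ∀ p q x → eval (p ⊖ q) x ≡ eval p x ℤ.- eval q x
  eval-⊖ []      q       x = trans (eval-negate q x) (sym (ℤ.+-identityˡ _))
  eval-⊖ (a ∷ p) []      x = sym (ℤ.+-identityʳ _)
  eval-⊖ (a ∷ p) (b ∷ q) x = begin
    eval ((a ∷ p) ⊖ (b ∷ q)) x  ≡⟨ eval-∷ (a ℤ.- b) (p ⊖ q) x ⟩
    (a ℤ.- b) ℤ.+ x ℤ.* eval (p ⊖ q) x  ≡⟨ cong (λ t → (a ℤ.- b) ℤ.+ x ℤ.* t) (eval-⊖ p q x) ⟩
    (a ℤ.- b) ℤ.+ x ℤ.* (eval p x ℤ.- eval q x)
      ≡⟨ solve 5 (λ a b x P Q → (a :- b) :+ x :* (P :- Q)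
                              := (a :+ x :* P) :- (b :+ x :* Q))
           refl a b x (eval p x) (eval q x) ⟩
    (a ℤ.+ x ℤ.* eval p x) ℤ.- (b ℤ.+ x ℤ.* eval q x)
      ≡⟨ cong₂ ℤ._-_ (eval-∷ a p x) (eval-∷ b q x) ⟨
    eval (a ∷ p) x ℤ.- eval (b ∷ q) x ∎
    where open ≡-Reasoning

  eval-X^ : ∀ n k → eval (X^ n) (+ k) ≡ + (k ℕ.^ n)
  eval-X^ zero    k = trans (eval-∷ (+ 1) [] (+ k))
    (cong (ℤ._+_ (+ 1)) (ℤ.*-zeroʳ (+ k)))
  eval-X^ (suc n) k = begin
    eval (X^ (suc n)) (+ k)             ≡⟨ eval-∷ (+ 0) (X^ n) (+ k) ⟩
    + 0 ℤ.+ + k ℤ.* eval (X^ n) (+ k)   ≡⟨ ℤ.+-identityˡ _ ⟩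
    + k ℤ.* eval (X^ n) (+ k)           ≡⟨ cong (ℤ._*_ (+ k)) (eval-X^ n k) ⟩
    + k ℤ.* + (k ℕ.^ n)                 ≡⟨ ℤ.pos-* k (k ℕ.^ n) ⟨
    + (k ℕ.^ suc n)                     ∎
    where open ≡-Reasoning

  funToFin-cong : ∀ {m k} {g h : Fin m → Fin k} → (∀ i → g i ≡ h i) →
                  funToFin g ≡ funToFin h
  funToFin-cong {zero}  eq = refl
  funToFin-cong {suc m} eq =
    cong₂ combine (eq zero) (funToFin-cong (eq ∘ suc))

  length-split : ∀ {A : Set} {P Q R : A → Set}
    (P? : ∀ x → Dec (P x)) (Q? : ∀ x → Dec (Q x)) (R? : ∀ x → Dec (R x)) →
    (∀ {x} → P x → Q x) → (∀ {x} → P x → ¬ R x) → (∀ {x} → R x → Q x) →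
    (∀ {x} → Q x → ¬ R x → P x) →
    ∀ xs → length (filter Q? xs) ≡ length (filter P? xs) ℕ.+ length (filter R? xs)
  length-split P? Q? R? P⇒Q P⇒¬R R⇒Q QR⇒P [] = refl
  length-split P? Q? R? P⇒Q P⇒¬R R⇒Q QR⇒P (x ∷ xs)
    with ih ← length-split P? Q? R? P⇒Q P⇒¬R R⇒Q QR⇒P xs | P? x | Q? x | R? x
  ... | yes p | yes q | yes r = ⊥-elim (P⇒¬R p r)
  ... | yes p | yes q | no ¬r = cong suc ih
  ... | yes p | no ¬q | _     = ⊥-elim (¬q (P⇒Q p))
  ... | no ¬p | yes q | yes r = trans (cong suc ih) (sym (+-suc _ _))
  ... | no ¬p | yes q | no ¬r = ⊥-elim (¬p (QR⇒P q ¬r))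
  ... | no ¬p | no ¬q | yes r = ⊥-elim (¬q (R⇒Q r))
  ... | no ¬p | no ¬q | no ¬r = ih

  module FirstEdge {v e : ℕ} (Γ : Graph (suc v) (suc e))
    (u≢w : proj₁ (Γ zero) ≢ proj₂ (Γ zero)) where

    u w : Fin (suc v)
    u = proj₁ (Γ zero)
    w = proj₂ (Γ zero)

    deletion : Graph (suc v) e
    deletion = Γ ∘ suc

    contraction : Graph v e
    contraction i = merge u≢w (proj₁ (Γ (suc i))) , merge u≢w (proj₂ (Γ (suc i)))

    module _ (k : ℕ) where
      Monochromatic : Fin (k ℕ.^ suc v) → Set
      Monochromatic i =
        Proper deletion (finToFun {k} {suc v} i) ×
        finToFun {k} {suc v} i u ≡ finToFun {k} {suc v} i w

      monochromatic? : ∀ i → Dec (Monochromatic i)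
      monochromatic? i = proper? deletion (finToFun {k} {suc v} i)
                   ×-dec (finToFun {k} {suc v} i u Fin.≟ finToFun {k} {suc v} i w)

      pull : Fin (k ℕ.^ v) → Fin (k ℕ.^ suc v)
      pull j = funToFin {suc v} {k} (finToFun {k} {v} j ∘ merge u≢w)

      pull-≗ : ∀ j x → finToFun {k} {suc v} (pull j) x ≡ finToFun {k} {v} j (merge u≢w x)
      pull-≗ j = Fin.finToFun-funToFin {suc v} {k} (finToFun {k} {v} j ∘ merge u≢w)

      pull-injective : ∀ {i j} → pull i ≡ pull j → i ≡ j
      pull-injective {i} {j} eq =
        trans (sym (Fin.funToFin-finToFin {v} {k} i))
          (trans (funToFin-cong same) (Fin.funToFin-finToFin {v} {k} j))
        where
        same : ∀ y → finToFun {k} {v} i y ≡ finToFun {k} {v} j y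
        same y = begin
          finToFun {k} {v} i y  ≡⟨ cong (finToFun {k} {v} i) (merge-punchIn u≢w y) ⟨
          finToFun {k} {v} i (merge u≢w (punchIn w y)) ≡⟨ pull-≗ i (punchIn w y) ⟨
          finToFun {k} {suc v} (pull i) (punchIn w y)
            ≡⟨ cong (λ t → finToFun {k} {suc v} t (punchIn w y)) eq ⟩
          finToFun {k} {suc v} (pull j) (punchIn w y) ≡⟨ pull-≗ j (punchIn w y) ⟩
          finToFun {k} {v} j (merge u≢w (punchIn w y))
            ≡⟨ cong (finToFun {k} {v} j) (merge-punchIn u≢w y) ⟩
          finToFun {k} {v} j y ∎
          where open ≡-Reasoning

      contracted? : ∀ j → Dec (Proper contraction (finToFun {k} {v} j))
      contracted? j = proper? contraction (finToFun {k} {v} j)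

      monochromatic-pull : ∀ {j} → Proper contraction (finToFun {k} {v} j) →
                           Monochromatic (pull j)
      monochromatic-pull {j} pr =
        (λ i eq → pr i (trans (sym (pull-≗ j (proj₁ (deletion i))))
          (trans eq (pull-≗ j (proj₂ (deletion i)))))) ,
        trans (pull-≗ j u)
          (trans (cong (finToFun {k} {v} j) (merge-identifies u≢w)) (sym (pull-≗ j w)))

      pull-surjective : ∀ {i} → Monochromatic i →
        ∃ λ j → Proper contraction (finToFun {k} {v} j) × i ≡ pull j
      pull-surjective {i} (pr , mono) = j , proper , sym pull-j
        where
        κ = finToFun {k} {suc v} i
        j = funToFin {v} {k} (κ ∘ punchIn w)
        lift : ∀ x → κ (punchIn w (merge u≢w x)) ≡ κ x
        lift x with punchIn-merge u≢w x
        ... | inj₁ (refl , p) = trans (cong κ p) mono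
        ... | inj₂ p          = cong κ p
        on-j : ∀ x → finToFun {k} {v} j (merge u≢w x) ≡ κ x
        on-j x = trans (Fin.finToFun-funToFin {v} {k} (κ ∘ punchIn w) _) (lift x)
        proper : Proper contraction (finToFun {k} {v} j)
        proper l eq = pr l (trans (sym (on-j (proj₁ (deletion l))))
          (trans eq (on-j (proj₂ (deletion l)))))
        pull-j : pull j ≡ i
        pull-j = trans (funToFin-cong on-j) (Fin.funToFin-finToFin {suc v} {k} i)

      length-contracted :
        length (filter monochromatic? (allFin (k ℕ.^ suc v))) ≡
        properColourings contraction k
      length-contracted = trans
        (↭-length (∼bag⇒↭ (unique∧set⇒bag
          (filter⁺ monochromatic? (allFin⁺ _))
          (map⁺ pull-injective (filter⁺ contracted? (allFin⁺ _)))
          (mk⇔ to from))))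
        (length-map pull (filter contracted? (allFin (k ℕ.^ v))))
        where
        to : ∀ {i} → i ∈ filter monochromatic? (allFin (k ℕ.^ suc v)) →
             i ∈ List.map pull (filter contracted? (allFin (k ℕ.^ v)))
        to i∈ with pull-surjective (proj₂ (∈-filter⁻ monochromatic? {xs = allFin (k ℕ.^ suc v)} i∈))
        ... | j , pr , refl = ∈-map⁺ pull (∈-filter⁺ contracted? (∈-allFin j) pr)
        from : ∀ {i} → i ∈ List.map pull (filter contracted? (allFin (k ℕ.^ v))) →
               i ∈ filter monochromatic? (allFin (k ℕ.^ suc v))
        from i∈ with ∈-map⁻ pull i∈
        ... | j , j∈ , refl = ∈-filter⁺ monochromatic? (∈-allFin _)
          (monochromatic-pull (proj₂ (∈-filter⁻ contracted? {xs = allFin (k ℕ.^ v)} j∈)))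

      deletion-contraction :
        properColourings deletion k ≡
        properColourings Γ k ℕ.+ properColourings contraction k
      deletion-contraction = trans
        (length-split _ _ monochromatic?
          (λ p i → p (suc i)) (λ p r → p zero (proj₂ r)) proj₁
          (λ { q ¬r zero eq → ¬r (q , eq) ; q ¬r (suc i) → q i })
          (allFin (k ℕ.^ suc v)))
        (cong (properColourings Γ k ℕ.+_) length-contracted)

  length-none : ∀ {A : Set} {P : A → Set} (P? : ∀ x → Dec (P x)) →
                (∀ x → ¬ P x) → ∀ xs → length (filter P? xs) ≡ 0
  length-none P? ¬P [] = refl
  length-none P? ¬P (x ∷ xs) with P? x
  ... | yes p = ⊥-elim (¬P x p)
  ... | no _  = length-none P? ¬P xs

  chromaticPolynomial : ∀ {v e} (Γ : Graph v e) → ∃ (IsChromaticPolynomial Γ)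
  chromaticPolynomial {v} {zero} Γ = X^ v , λ k → trans (eval-X^ v k)
    (cong +_ (sym (trans
      (cong length (filter-all (λ i → proper? Γ (finToFun {k} {v} i))
        (All.universal (λ _ ()) (allFin (k ℕ.^ v)))))
      (length-tabulate (id {A = Fin (k ℕ.^ v)})))))
  chromaticPolynomial {v} {suc e} Γ with proj₁ (Γ zero) Fin.≟ proj₂ (Γ zero)
  ... | yes loop = [] , λ k → cong +_ (sym
    (length-none (λ i → proper? Γ (finToFun {k} {v} i))
      (λ i pr → pr zero (cong (finToFun {k} {v} i) loop)) (allFin (k ℕ.^ v))))
  chromaticPolynomial {suc v} {suc e} Γ | no u≢w =
    proj₁ D ⊖ proj₁ C , λ k → begin
      eval (proj₁ D ⊖ proj₁ C) (+ k)                  ≡⟨ eval-⊖ (proj₁ D) (proj₁ C) (+ k) ⟩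
      eval (proj₁ D) (+ k) ℤ.- eval (proj₁ C) (+ k)   ≡⟨ cong₂ ℤ._-_ (proj₂ D k) (proj₂ C k) ⟩
      + properColourings deletion k ℤ.- + properColourings contraction k
        ≡⟨ cong (λ t → + t ℤ.- + properColourings contraction k) (deletion-contraction k) ⟩
      + properColourings Γ k ℤ.+ + properColourings contraction k
        ℤ.- + properColourings contraction k
        ≡⟨ solve 2 (λ x y → x :+ y :- y := x) refl
             (+ properColourings Γ k) (+ properColourings contraction k) ⟩
      + properColourings Γ k ∎
    where
    open FirstEdge Γ u≢w
    open ≡-Reasoning
    D = chromaticPolynomial deletion
    C = chromaticPolynomial contraction
  chromaticPolynomial {zero} {suc e} Γ | no _ = ⊥-elim (Fin.¬Fin0 (proj₁ (Γ zero)))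

open DeletionContraction public using (chromaticPolynomial)

------------------------------------------------------------------------
-- Embedded graphs, as arrow presentations

-- The two arrows carrying a given label, and the two ends of an arrow.
data Arrow : Set where
  α β : Arrow

data End : Set where
  tail tip : End

other : Arrow → Arrow
other α = β
other β = α

opposite : End → End
opposite tail = tip
opposite tip  = tail

ArrowEnd : ℕ → Set
ArrowEnd m = Fin m × Arrow × End

-- The arrows cut the circles that carry at least one arrow into the
-- arrows themselves and the arcs between consecutive arrows.  Those
-- arcs match up the ends of the arrows in pairs, and the matching `arc`
-- determines the circles: each alternates between arrows and arcs.
-- Every fixed-point-free involution arises in this way.
record EmbeddedGraph : Set where
  field
    edges        : ℕ
    emptyCircles : ℕ   -- circles carrying no arrow (isolated vertices)
    arc          : ArrowEnd edges → ArrowEnd edges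
    arc-involutive  : ∀ x → arc (arc x) ≡ x
    arc-fixedPtFree : ∀ x → arc x ≢ x

open EmbeddedGraph public

-- The move along an arrow, from one of its ends to the other.
along : ∀ {m} → ArrowEnd m → ArrowEnd m
along (e , a , s) = e , a , opposite s

-- The move along a free side of an edge disc: since both arrows agree
-- with the orientation of its boundary, the sides join the tip of each
-- arrow to the tail of the other one.
across : ∀ {m} → ArrowEnd m → ArrowEnd m
across (e , a , s) = e , other a , opposite s

-- Part of the boundary of the spanning ribbon subgraph with edge set A:
-- sides of the edge discs in A, and the arcs of vertex discs to which
-- the edges outside A were attached.
side : ∀ {m} → Subset m → ArrowEnd m → ArrowEnd m
side A x@(e , _) = if lookup A e then across x else along x

module _ (G : EmbeddedGraph) where

  -- An empty circle is represented by a single point.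
  Point : Set
  Point = ArrowEnd (edges G) ⊎ Fin (emptyCircles G)

  private
    halves : (Arrow × End) ↔ Fin 4
    halves = mk↔ₛ′
      (λ { (α , tail) → 0F ; (α , tip) → 1F ; (β , tail) → 2F ; (β , tip) → 3F })
      (λ { 0F → α , tail ; 1F → α , tip ; 2F → β , tail ; 3F → β , tip })
      (λ { 0F → refl ; 1F → refl ; 2F → refl ; 3F → refl })
      (λ { (α , tail) → refl ; (α , tip) → refl ; (β , tail) → refl ; (β , tip) → refl })

  points : Point ↔ Fin (edges G ℕ.* 4 ℕ.+ emptyCircles G)
  points = ↔-sym Fin.+↔⊎ ↔-∘
    ((↔-sym Fin.*↔× ↔-∘ (↔-id _ ×-↔ halves)) ⊎-↔ ↔-id _)

  private
    traced : (ms : List (ArrowEnd (edges G) → ArrowEnd (edges G))) →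
             Classes (Step (List.map map₁ ms))
    traced ms = orbits points (List.map map₁ ms)

  circles : Classes (Step (List.map map₁ (arc G ∷ along ∷ [])))
  circles = traced (arc G ∷ along ∷ [])

  components : (A : Subset (edges G)) →
               Classes (Step (List.map map₁ (arc G ∷ along ∷ side A ∷ [])))
  components A = traced (arc G ∷ along ∷ side A ∷ [])

  boundaries : (A : Subset (edges G)) →
               Classes (Step (List.map map₁ (arc G ∷ side A ∷ [])))
  boundaries A = traced (arc G ∷ side A ∷ [])

  vertices : ℕ
  vertices = Classes.count circles

  underlyingGraph : Graph vertices (edges G)
  underlyingGraph e = Classes.class circles (inj₁ (e , α , tail))
                    , Classes.class circles (inj₁ (e , β , tail))

  -- Parameters of the spanning ribbon subgraph with edge set A.  The
  -- subtractions here and in the exponents below never truncate.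
  c r n f : Subset (edges G) → ℕ
  c A = Classes.count (components A)
  r A = vertices ∸ c A
  n A = ∣ A ∣ ∸ r A
  f A = Classes.count (boundaries A)

  -- 2 c(G) minus the Euler characteristic of the surface in which G is
  -- cellularly embedded, obtained by capping off the boundary of the
  -- ribbon graph.
  eulerGenus : ℤ
  eulerGenus = + (2 ℕ.* c ⊤) ℤ.- (+ vertices ℤ.- + edges G ℤ.+ + f ⊤)

  Plane : Set
  Plane = c ⊤ ≡ 1 × eulerGenus ≡ + 0

------------------------------------------------------------------------
-- Partial duals and Petrie duals

-- Replacing arrows by new ones having the same set of ends: the end x of
-- a new arrow is placed where the old end `to (φ e) x` was, and the arcs
-- between arrows stay in place.
redraw : (G : EmbeddedGraph) → (Fin (edges G) → (Arrow × End) ↔ (Arrow × End)) →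
         EmbeddedGraph
redraw G φ = record
  { edges        = edges G
  ; emptyCircles = emptyCircles G
  ; arc          = λ x → unplace (arc G (place x))
  ; arc-involutive = λ x → trans
      (cong (unplace ∘ arc G) (place-unplace (arc G (place x))))
      (trans (cong unplace (arc-involutive G (place x))) (unplace-place x))
  ; arc-fixedPtFree = λ x eq → arc-fixedPtFree G (place x)
      (trans (sym (place-unplace _)) (cong place eq))
  }
  where
  place unplace : ArrowEnd (edges G) → ArrowEnd (edges G)
  place   (e , h) = e , Inverse.to   (φ e) h
  unplace (e , h) = e , Inverse.from (φ e) h
  place-unplace : ∀ x → place (unplace x) ≡ x
  place-unplace (e , h) = cong (e ,_) (Inverse.strictlyInverseˡ (φ e) h)
  unplace-place : ∀ x → unplace (place x) ≡ x
  unplace-place (e , h) = cong (e ,_) (Inverse.strictlyInverseʳ (φ e) h)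

-- The new arrows run from the tip of α to the tail of β and from the tip
-- of β to the tail of α.
dualArrows : (Arrow × End) ↔ (Arrow × End)
dualArrows = mk↔ₛ′
  (λ { (α , tail) → α , tip ; (α , tip) → β , tail
     ; (β , tail) → β , tip ; (β , tip) → α , tail })
  (λ { (α , tip) → α , tail ; (β , tail) → α , tip
     ; (β , tip) → β , tail ; (α , tail) → β , tip })
  (λ { (α , tail) → refl ; (α , tip) → refl ; (β , tail) → refl ; (β , tip) → refl })
  (λ { (α , tail) → refl ; (α , tip) → refl ; (β , tail) → refl ; (β , tip) → refl })

reverseβ : (Arrow × End) ↔ (Arrow × End)
reverseβ = mk↔ₛ′ rev rev invol invol
  where
  rev : Arrow × End → Arrow × End
  rev (α , s) = α , s
  rev (β , s) = β , opposite s
  invol : ∀ x → rev (rev x) ≡ x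
  invol (α , s)    = refl
  invol (β , tail) = refl
  invol (β , tip)  = refl

partialDual : (G : EmbeddedGraph) → Subset (edges G) → EmbeddedGraph
partialDual G A = redraw G λ e → if lookup A e then dualArrows else ↔-id _

petrieDual : EmbeddedGraph → EmbeddedGraph
petrieDual G = redraw G λ _ → reverseβ

------------------------------------------------------------------------
-- Graph polynomials, evaluated in a commutative ring

module GraphPolynomials {a ℓ} (K : CommutativeRing a ℓ) where
  open CommutativeRing K
  open Exp semiring using (_^_)
  open Evaluation K

  R : EmbeddedGraph → Carrier → Carrier → Carrier → Carrier
  R G x y z = ∑⊆ (edges G) λ A →
    (x - 1#) ^ (r G ⊤ ∸ r G A) * y ^ n G A * z ^ ((c G A ℕ.+ n G A) ∸ f G A)

  T : EmbeddedGraph → Carrier → Carrier → Carrier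
  T G x y = ∑⊆ (edges G) λ A →
    (x - 1#) ^ (r G ⊤ ∸ r G A) * (y - 1#) ^ n G A

  χ : EmbeddedGraph → Carrier → Carrier
  χ G = eval (proj₁ (chromaticPolynomial (underlyingGraph G)))

{-# OPTIONS --safe #-}

-- Left-hand side.  Collecting the powers of l, the term of A becomes
-- (-1)^|A| l^f(A) (for (2) this uses f(A) = c(A) + n(A), as all spanning ribbon
-- subgraphs of a plane graph have Euler genus 0).  That no subtraction
-- truncates amounts to the Euler genus being non-negative; that and its
-- monotonicity in A are proved by inserting edges one at a time.
--
-- Right-hand side.  It suffices to take l = k natural, since an integer
-- polynomial vanishing at all positive integers has zero coefficients.  Then
-- k^f(A) counts the k-colourings κ of the points (ends of arrows and empty
-- circles) that are constant along arcs and, at each edge, on both pairs of one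
-- of two pairings of its four ends: across (e ∈ A) or along (e ∉ A).  A proper
-- colouring of the Petrie dual of the partial dual is such a κ that is moreover
-- not constant on the four ends of any edge.  For fixed κ both signed sums over
-- A factor over the edges, with factors [along] - [across]; those of the two
-- sides agree, because the monochromatic contributions cancel.

module Submission where

open import Defs
open DeletionContraction using (_⊖_; negate; X^; funToFin-cong)
open import Level using (Level; 0ℓ)
open import Algebra.Bundles using (CommutativeRing)
import Algebra.Properties.AbelianGroup as AbelianGroupProperties
import Algebra.Properties.CommutativeSemigroup as CommutativeSemigroupProperties
import Algebra.Properties.CommutativeSemiring.Exp as CommExp
import Algebra.Properties.Monoid.Mult as MonoidMult
import Algebra.Properties.Ring as RingProperties
import Algebra.Properties.Semiring.Exp as Exp
open import Data.Bool.Base using (Bool; true; false; if_then_else_; _∧_)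
open import Data.Empty using (⊥-elim) renaming (⊥ to Empty)
open import Data.Fin.Base using (Fin; zero; suc; finToFun; funToFin)
import Data.Fin.Properties as Fin
open import Data.Fin.Subset using (Subset; inside; outside; ⊤; ∣_∣) renaming (⊥ to ∅)
open import Data.Fin.Subset.Properties using (∣⊥∣≡0; ∣⊤∣≡n)
open import Data.Integer.Base as ℤ using (ℤ; +_; -[1+_])
import Data.Integer.Properties as ℤ
open import Data.Integer.Solver using () renaming (module +-*-Solver to ℤ-Solver)
open import Data.List.Base as List using (List; []; _∷_; length; filter; allFin)
open import Data.List.Membership.Propositional using (_∈_)
open import Data.List.Membership.Propositional.Properties
  using (∈-allFin; ∈-map⁺; ∈-map⁻; ∈-filter⁺; ∈-filter⁻)
open import Data.List.Membership.Propositional.Properties.WithK using (unique∧set⇒bag)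
open import Data.List.Properties using (length-map; length-tabulate; filter-all)
open import Data.List.Relation.Binary.BagAndSetEquality using (∼bag⇒↭)
open import Data.List.Relation.Binary.Permutation.Propositional.Properties using (↭-length)
open import Data.List.Relation.Unary.All as All using (All; []; _∷_)
open import Data.List.Relation.Unary.Any using (here; there)
open import Data.List.Relation.Unary.Unique.Propositional.Properties
  using (map⁺; filter⁺; allFin⁺)
open import Data.Nat.Base as ℕ using (ℕ; zero; suc; s≤s; _∸_)
import Data.Nat.Divisibility as ℕ
import Data.Nat.Properties as ℕ
open import Data.Nat.Solver using (module +-*-Solver)
open import Data.Product.Base using (∃; _×_; _,_; proj₁; proj₂)
open import Data.Product.Properties using (≡-dec)
open import Data.Sum.Base using (_⊎_; inj₁; inj₂; map₁)
import Data.Sum.Properties as Sum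
open import Data.Unit.Base using (tt) renaming (⊤ to Unit)
open import Data.Vec.Base using ([]; _∷_; lookup)
open import Data.Vec.Functional using (removeAt)
open import Data.Vec.Properties using (lookup-replicate)
open import Algebra.Properties.CommutativeMonoid.Sum ℕ.+-0-commutativeMonoid
  using (sum; sum-remove; sum-permute; sum-cong-≗; ∑-distrib-+)
open import Function.Base using (_∘_; id)
open import Function.Bundles using (_↔_; _⇔_; Inverse; Equivalence; mk⇔; mk↔ₛ′)
open import Function.Construct.Composition using (_↔-∘_)
open import Function.Construct.Identity using (↔-id)
open import Relation.Binary.Construct.Closure.Equivalence as EqC using ()
open import Relation.Binary.Core using (Rel)
open import Relation.Binary.Definitions using (tri<; tri≈; tri>)
open import Relation.Binary.PropositionalEquality
  using (_≡_; _≢_; refl; sym; trans; cong; cong₂; subst; isEquivalence; module ≡-Reasoning)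
open import Relation.Nullary using (¬_; Dec; yes; no; does; ¬?; _×-dec_; contradiction)
open import Relation.Nullary.Decidable using (dec-true; dec-false; does-⇔)

-- Comparing the numbers of classes of two relations

module _ {A : Set} {_~_ : Rel A 0ℓ} (C : Classes _~_) where
  open Classes C

  class-resp : ∀ {x y} → x ~ y → class x ≡ class y
  class-resp x~y = Equivalence.from (class-≡ _ _) (EqC.return x~y)

  class-elim : ∀ {B : Set} (h : A → B) → (∀ {x y} → x ~ y → h x ≡ h y) →
               ∀ {x y} → class x ≡ class y → h x ≡ h y
  class-elim h resp eq =
    EqC.gfold isEquivalence h resp (Equivalence.to (class-≡ _ _) eq)

  rep : Fin count → A
  rep i = proj₁ (surjective i)

  class-rep : ∀ i → class (rep i) ≡ i
  class-rep i = proj₂ (surjective i)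

module _ {A : Set} {_~_ _~′_ : Rel A 0ℓ} (C : Classes _~_) (C′ : Classes _~′_) where
  open Classes C using (count; class)
  open Classes C′ using () renaming (count to count′; class to class′)

  -- As `C` refines `C′`, the class in `C` of a chosen representative of a `C′`-class determines
  -- that `C′`-class.
  count-≤ : (∀ {x y} → x ~ y → class′ x ≡ class′ y) → count′ ℕ.≤ count
  count-≤ resp = Fin.injective⇒≤ {f = class ∘ rep C′} λ {i} {j} eq → begin
    i                   ≡⟨ class-rep C′ i ⟨
    class′ (rep C′ i)   ≡⟨ class-elim C class′ resp eq ⟩
    class′ (rep C′ j)   ≡⟨ class-rep C′ j ⟩
    j                   ∎
    where open ≡-Reasoning

  module _ {u v : A} where

    -- C′ may merge the classes of u and v, but nothing else.
    count-≤-suc : (∀ {x y} → x ~′ y → class x ≡ class y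
                   ⊎ (class x ≡ class u × class y ≡ class v)
                   ⊎ (class x ≡ class v × class y ≡ class u)) →
                  count ℕ.≤ suc count′
    count-≤-suc gen = Fin.injective⇒≤ {f = code} (λ {i} {j} → code-injective i j)
      where
      -- Moving `class u` onto `class v` makes `h ∘ class` constant along `_~′_`. Since `h` fixes
      -- everything else, `class′` separates all classes other than `class u`, for which `code`
      -- reserves the extra value `zero`.
      h : Fin count → Fin count
      h i with i Fin.≟ class u
      ... | yes _ = class v
      ... | no  _ = i

      h-u : h (class u) ≡ class v
      h-u with class u Fin.≟ class u
      ... | yes _  = refl
      ... | no u≢u = contradiction refl u≢u

      h-v : h (class v) ≡ class v
      h-v with class v Fin.≟ class u
      ... | yes _ = refl
      ... | no _  = refl

      h-other : ∀ {i} → i ≢ class u → h i ≡ i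
      h-other {i} i≢u with i Fin.≟ class u
      ... | yes i≡u = contradiction i≡u i≢u
      ... | no _    = refl

      h-resp : ∀ {x y} → x ~′ y → h (class x) ≡ h (class y)
      h-resp x~y with gen x~y
      ... | inj₁ eq              = cong h eq
      ... | inj₂ (inj₁ (xu , yv)) = trans (trans (cong h xu) h-u) (sym (trans (cong h yv) h-v))
      ... | inj₂ (inj₂ (xv , yu)) = trans (trans (cong h xv) h-v) (sym (trans (cong h yu) h-u))

      code : Fin count → Fin (suc count′)
      code i with i Fin.≟ class u
      ... | yes _ = zero
      ... | no _  = suc (class′ (rep C i))

      code-injective : ∀ i j → code i ≡ code j → i ≡ j
      code-injective i j eq with i Fin.≟ class u | j Fin.≟ class u
      ... | yes i≡u | yes j≡u = trans i≡u (sym j≡u)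
      ... | no i≢u  | no j≢u  = begin
        i                   ≡⟨ h-other i≢u ⟨
        h i                 ≡⟨ cong h (class-rep C i) ⟨
        h (class (rep C i)) ≡⟨ class-elim C′ (h ∘ class) h-resp (Fin.suc-injective eq) ⟩
        h (class (rep C j)) ≡⟨ cong h (class-rep C j) ⟩
        h j                 ≡⟨ h-other j≢u ⟩
        j                   ∎
        where open ≡-Reasoning

    -- If the common `C′`-class of `u` and `v` is represented by `u`, no representative of a
    -- `C′`-class lies in `class v`, which is thus an additional class of `C`.
    count-< : (∀ {x y} → x ~ y → class′ x ≡ class′ y) →
              class u ≢ class v → class′ u ≡ class′ v → count′ ℕ.< count
    count-< resp u≁v u~′v = Fin.injective⇒≤ {f = code} (λ {i} {j} → code-injective i j)
      where
      rep′ : Fin count′ → A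
      rep′ i with i Fin.≟ class′ u
      ... | yes _ = u
      ... | no _  = rep C′ i

      class-rep′ : ∀ i → class′ (rep′ i) ≡ i
      class-rep′ i with i Fin.≟ class′ u
      ... | yes i≡u = sym i≡u
      ... | no _    = class-rep C′ i

      rep′-≢v : ∀ i → class (rep′ i) ≢ class v
      rep′-≢v i eq with i Fin.≟ class′ u
      ... | yes _  = u≁v eq
      ... | no i≢u = i≢u (begin
        i                 ≡⟨ class-rep C′ i ⟨
        class′ (rep C′ i) ≡⟨ class-elim C class′ resp eq ⟩
        class′ v          ≡⟨ u~′v ⟨
        class′ u          ∎)
        where open ≡-Reasoning

      code : Fin (suc count′) → Fin count
      code zero    = class v
      code (suc i) = class (rep′ i)

      code-injective : ∀ i j → code i ≡ code j → i ≡ j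
      code-injective zero    zero    eq = refl
      code-injective zero    (suc j) eq = contradiction (sym eq) (rep′-≢v j)
      code-injective (suc i) zero    eq = contradiction eq (rep′-≢v i)
      code-injective (suc i) (suc j) eq = cong suc (begin
        i                ≡⟨ class-rep′ i ⟨
        class′ (rep′ i)  ≡⟨ class-elim C class′ resp eq ⟩
        class′ (rep′ j)  ≡⟨ class-rep′ j ⟩
        j                ∎)
        where open ≡-Reasoning

-- Parity of sets closed under fixed-point-free involutions

𝟙 : Bool → ℕ
𝟙 b = if b then 1 else 0

sum-without-one : ∀ {N} (S S′ : Fin N → Bool) i → S i ≡ true → S′ i ≡ false →
                  (∀ j → j ≢ i → S j ≡ S′ j) → sum (𝟙 ∘ S) ≡ suc (sum (𝟙 ∘ S′))
sum-without-one {suc N} S S′ i Si S′i same = begin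
  sum (𝟙 ∘ S)                                    ≡⟨ sum-remove {i = i} (𝟙 ∘ S) ⟩
  𝟙 (S i) ℕ.+ sum (removeAt (𝟙 ∘ S) i)           ≡⟨ cong₂ (λ b t → 𝟙 b ℕ.+ t) Si
      (sum-cong-≗ λ j → cong 𝟙 (same _ (Fin.punchInᵢ≢i i j))) ⟩
  suc (sum (removeAt (𝟙 ∘ S′) i))
    ≡⟨ cong (λ b → suc (𝟙 b ℕ.+ sum (removeAt (𝟙 ∘ S′) i))) S′i ⟨
  suc (𝟙 (S′ i) ℕ.+ sum (removeAt (𝟙 ∘ S′) i))   ≡⟨ cong suc (sum-remove {i = i} (𝟙 ∘ S′)) ⟨
  suc (sum (𝟙 ∘ S′))                             ∎
  where open ≡-Reasoning

module _ {N : ℕ} (S : Fin N → Bool) (ι : Fin N → Fin N)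
  (invol : ∀ x → ι (ι x) ≡ x) (closed : ∀ x → S (ι x) ≡ S x)
  (fixedPtFree : ∀ x → S x ≡ true → ι x ≢ x) where

  -- Each orbit {x , ι x} inside S contains exactly one x with x < ι x.
  sum-even : ∃ λ p → sum (𝟙 ∘ S) ≡ 2 ℕ.* p
  sum-even = sum low , (begin
    sum (𝟙 ∘ S)                  ≡⟨ sum-cong-≗ split ⟩
    sum (λ x → low x ℕ.+ low (ι x)) ≡⟨ ∑-distrib-+ low (low ∘ ι) ⟩
    sum low ℕ.+ sum (low ∘ ι)
      ≡⟨ cong (sum low ℕ.+_) (sum-permute low (mk↔ₛ′ ι ι invol invol)) ⟨
    sum low ℕ.+ sum low          ≡⟨ cong (sum low ℕ.+_) (ℕ.+-identityʳ _) ⟨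
    2 ℕ.* sum low                ∎)
    where
    open ≡-Reasoning
    low : Fin N → ℕ
    low x = 𝟙 (S x ∧ does (x Fin.<? ι x))
    split : ∀ x → 𝟙 (S x) ≡ low x ℕ.+ low (ι x)
    split x rewrite closed x | invol x with S x in Sx
    ... | false = refl
    ... | true with Fin.<-cmp x (ι x)
    ...   | tri≈ _ eq _ = contradiction (sym eq) (fixedPtFree x Sx)
    ...   | tri< p _ ¬q
      rewrite dec-true (x Fin.<? ι x) p | dec-false (ι x Fin.<? x) ¬q = refl
    ...   | tri> ¬p _ q
      rewrite dec-false (x Fin.<? ι x) ¬p | dec-true (ι x Fin.<? x) q = refl

module _ {A : Set} {N : ℕ} (A↔N : A ↔ Fin N) {ι₁ ι₂ : A → A}
  (invol₁ : ∀ x → ι₁ (ι₁ x) ≡ x) (invol₂ : ∀ x → ι₂ (ι₂ x) ≡ x)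
  {S : A → Set} (S? : ∀ x → Dec (S x)) where
  open Inverse A↔N

  private
    transport-invol : ∀ {ι : A → A} → (∀ x → ι (ι x) ≡ x) →
                      ∀ i → to (ι (from (to (ι (from i))))) ≡ i
    transport-invol {ι} invol i = begin
      to (ι (from (to (ι (from i)))))  ≡⟨ cong (to ∘ ι) (strictlyInverseʳ _) ⟩
      to (ι (ι (from i)))              ≡⟨ cong to (invol _) ⟩
      to (from i)                      ≡⟨ strictlyInverseˡ i ⟩
      i                                ∎
      where open ≡-Reasoning

    even : ∀ {ι : A → A} → (∀ x → ι (ι x) ≡ x) → {P : A → Set} (P? : ∀ x → Dec (P x)) →
           (∀ {x} → P x → P (ι x)) → (∀ {x} → P x → ι x ≢ x) →
           ∃ λ p → sum (λ i → 𝟙 (does (P? (from i)))) ≡ 2 ℕ.* p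
    even {ι} invol {P} P? closed free = sum-even (λ i → does (P? (from i))) (to ∘ ι ∘ from)
      (transport-invol {ι} invol)
      (λ i → does-⇔ (mk⇔
        (λ p → subst P (invol _) (closed (subst P (strictlyInverseʳ _) p)))
        (λ p → subst P (sym (strictlyInverseʳ _)) (closed p)))
        (P? (from (to (ι (from i))))) (P? (from i)))
      (λ i Si eq → free (does⇒ (P? (from i)) Si)
        (trans (sym (strictlyInverseʳ _)) (cong from eq)))
      where
      does⇒ : ∀ {Q : Set} (Q? : Dec Q) → does Q? ≡ true → Q
      does⇒ (yes q) _ = q

  -- S and S ∖ {a} cannot both have an even number of elements.
  involutions-conflict : ∀ (_≟_ : ∀ (x y : A) → Dec (x ≡ y)) {a} → S a →
    (∀ {x} → S x → S (ι₁ x)) → (∀ {x} → S x → ι₁ x ≢ x) →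
    (∀ {x} → S x → x ≢ a → S (ι₂ x) × ι₂ x ≢ a) →
    (∀ {x} → S x → x ≢ a → ι₂ x ≢ x) → Empty
  involutions-conflict _≟_ {a} Sa closed₁ free₁ closed₂ free₂
    with even invol₁ S? closed₁ free₁
       | even invol₂ (λ x → S? x ×-dec ¬? (x ≟ a))
           (λ { (s , x≢a) → closed₂ s x≢a }) (λ { (s , x≢a) → free₂ s x≢a })
  ... | p , p-eq | q , q-eq = ℕ.even≢odd p q (begin
      2 ℕ.* p       ≡⟨ p-eq ⟨
      _             ≡⟨ sum-without-one _ _ (to a)
                         (dec-true (S? _) (subst S (sym (strictlyInverseʳ a)) Sa))
                         (dec-false (S? _ ×-dec ¬? (_ ≟ a)) λ { (_ , ≢a) → ≢a (strictlyInverseʳ a) })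
                         (λ j j≢ → does-⇔ (mk⇔
                           (λ s → s , λ eq → j≢ (trans (sym (strictlyInverseˡ j)) (cong to eq)))
                           proj₁) (S? _) (S? _ ×-dec ¬? (_ ≟ a))) ⟩
      suc _         ≡⟨ cong suc q-eq ⟩
      suc (2 ℕ.* q) ∎)
    where open ≡-Reasoning

-- Insertion of an edge

data Insert : ∀ {m} → Fin m → Subset m → Subset m → Set where
  here  : ∀ {m} {A : Subset m} → Insert zero (outside ∷ A) (inside ∷ A)
  there : ∀ {m} {e} {A B : Subset m} {b} → Insert e A B → Insert (suc e) (b ∷ A) (b ∷ B)

insert-outside : ∀ {m} {e : Fin m} {A B} → Insert e A B → lookup A e ≡ outside
insert-outside here      = refl
insert-outside (there i) = insert-outside i

insert-inside : ∀ {m} {e : Fin m} {A B} → Insert e A B → lookup B e ≡ inside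
insert-inside here      = refl
insert-inside (there i) = insert-inside i

insert-elsewhere : ∀ {m} {e : Fin m} {A B} → Insert e A B →
                   ∀ {e′} → e′ ≢ e → lookup A e′ ≡ lookup B e′
insert-elsewhere here      {zero}  ≢e = contradiction refl ≢e
insert-elsewhere here      {suc _} ≢e = refl
insert-elsewhere (there i) {zero}  ≢e = refl
insert-elsewhere (there i) {suc _} ≢e = insert-elsewhere i (≢e ∘ cong suc)

insert-size : ∀ {m} {e : Fin m} {A B} → Insert e A B → ∣ B ∣ ≡ suc ∣ A ∣
insert-size here                    = refl
insert-size (there {b = inside} i)  = cong suc (insert-size i)
insert-size (there {b = outside} i) = insert-size i

module _ {ℓ : Level} where

  -- The relation is arbitrary so that the recursion can restrict it to subsets with first entry
  -- `outside`; the first edge is then inserted last.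
  from-empty : ∀ {m} (_≼_ : Rel (Subset m) ℓ) → (∀ {A} → A ≼ A) →
    (∀ {A B C} → A ≼ B → B ≼ C → A ≼ C) →
    (∀ {e A B} → Insert e A B → A ≼ B) → ∀ A → ∅ ≼ A
  from-empty _≼_ rfl trns step []      = rfl
  from-empty _≼_ rfl trns step (b ∷ A)
    with from-empty (λ A B → (outside ∷ A) ≼ (outside ∷ B)) rfl trns (step ∘ there) A
  from-empty _≼_ rfl trns step (outside ∷ A) | ≼A = ≼A
  from-empty _≼_ rfl trns step (inside ∷ A)  | ≼A = trns ≼A (step here)

  -- Here a missing first edge is inserted first, and the recursion restricts the relation to
  -- subsets containing it.
  to-full : ∀ {m} (_≼_ : Rel (Subset m) ℓ) → (∀ {A} → A ≼ A) →
    (∀ {A B C} → A ≼ B → B ≼ C → A ≼ C) →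
    (∀ {e A B} → Insert e A B → A ≼ B) → ∀ A → A ≼ ⊤
  to-full _≼_ rfl trns step []      = rfl
  to-full _≼_ rfl trns step (b ∷ A)
    with to-full (λ A B → (inside ∷ A) ≼ (inside ∷ B)) rfl trns (step ∘ there) A
  to-full _≼_ rfl trns step (inside ∷ A)  | ≼⊤ = ≼⊤
  to-full _≼_ rfl trns step (outside ∷ A) | ≼⊤ = trns (step here) ≼⊤

-- The moves on the ends of arrows

along-involutive : ∀ {m} (x : ArrowEnd m) → along (along x) ≡ x
along-involutive (e , a , tail) = refl
along-involutive (e , a , tip)  = refl

across-involutive : ∀ {m} (x : ArrowEnd m) → across (across x) ≡ x
across-involutive (e , α , tail) = refl
across-involutive (e , α , tip)  = refl
across-involutive (e , β , tail) = refl
across-involutive (e , β , tip)  = refl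

module _ {m : ℕ} where

  side-outside : ∀ (A : Subset m) {e} h → lookup A e ≡ outside → side A (e , h) ≡ along (e , h)
  side-outside A h eq rewrite eq = refl

  side-inside : ∀ (A : Subset m) {e} h → lookup A e ≡ inside → side A (e , h) ≡ across (e , h)
  side-inside A h eq rewrite eq = refl

  side-cong : ∀ (A B : Subset m) {e} h → lookup A e ≡ lookup B e → side A (e , h) ≡ side B (e , h)
  side-cong A B h eq rewrite eq = refl

  side-edge : ∀ (A : Subset m) e h → proj₁ (side A (e , h)) ≡ e
  side-edge A e h with lookup A e
  ... | inside  = refl
  ... | outside = refl

  side-involutive : ∀ (A : Subset m) x → side A (side A x) ≡ x
  side-involutive A (e , h) with lookup A e in eq
  ... | inside  rewrite eq = across-involutive (e , h)
  ... | outside rewrite eq = along-involutive (e , h)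

  side-fixedPtFree : ∀ (A : Subset m) x → side A x ≢ x
  side-fixedPtFree A (e , a , s) with lookup A e
  side-fixedPtFree A (e , α , tail) | inside  = λ ()
  side-fixedPtFree A (e , α , tip)  | inside  = λ ()
  side-fixedPtFree A (e , β , tail) | inside  = λ ()
  side-fixedPtFree A (e , β , tip)  | inside  = λ ()
  side-fixedPtFree A (e , a , tail) | outside = λ ()
  side-fixedPtFree A (e , a , tip)  | outside = λ ()

_≟ᴬ_ : (a b : Arrow) → Dec (a ≡ b)
α ≟ᴬ α = yes refl
α ≟ᴬ β = no λ ()
β ≟ᴬ α = no λ ()
β ≟ᴬ β = yes refl

_≟ᴱ_ : (s t : End) → Dec (s ≡ t)
tail ≟ᴱ tail = yes refl
tail ≟ᴱ tip  = no λ ()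
tip  ≟ᴱ tail = no λ ()
tip  ≟ᴱ tip  = yes refl

module _ {A B : Set} where

  -- Every move fixes the empty circles, so reflexivity settles them and only the ends of arrows
  -- remain to be checked.
  step-elim : ∀ {ms : List (A → A)} (P : Rel (A ⊎ B) 0ℓ) → (∀ {x} → P x x) →
    All (λ m → ∀ x → P (inj₁ x) (inj₁ (m x))) ms →
    ∀ {x y} → Step (List.map map₁ ms) x y → P x y
  step-elim P rfl moves {x} (_ , m∈ , refl) with ∈-map⁻ map₁ m∈
  step-elim P rfl moves {inj₁ x} _ | m , m∈ , refl = All.lookup moves m∈ x
  step-elim P rfl moves {inj₂ _} _ | m , m∈ , refl = rfl

  step-class : ∀ {ms : List (A → A)} {R : Rel (A ⊎ B) 0ℓ} (C : Classes R) →
    All (λ m → ∀ x → Classes.class C (inj₁ x) ≡ Classes.class C (inj₁ (m x))) ms →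
    ∀ {x y} → Step (List.map map₁ ms) x y → Classes.class C x ≡ Classes.class C y
  step-class C = step-elim (λ x y → Classes.class C x ≡ Classes.class C y) refl

  move : ∀ {ms : List (A → A)} (C : Classes (Step {A ⊎ B} (List.map map₁ ms))) {m} →
         m ∈ ms → ∀ x → Classes.class C (inj₁ x) ≡ Classes.class C (inj₁ (m x))
  move C m∈ x = class-resp C (_ , ∈-map⁺ map₁ m∈ , refl)

-- Effect of inserting one edge on components and boundary components

module _ (G : EmbeddedGraph) {e : Fin (edges G)} {A B : Subset (edges G)}
         (ins : Insert e A B) where
  private
    module CA = Classes (components G A)
    module CB = Classes (components G B)
    module FA = Classes (boundaries G A)
    module FB = Classes (boundaries G B)

    ↑ : ArrowEnd (edges G) → Point G
    ↑ = inj₁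

    -- A common quotient of the boundaries of A and of B, obtained from either
    -- by identifying at most two classes.
    merged : Classes (Step {Point G} (List.map map₁ (arc G ∷ side A ∷ side B ∷ [])))
    merged = orbits (points G) _
    module M = Classes merged

    αt αp βt βp : ArrowEnd (edges G)
    αt = e , α , tail
    αp = e , α , tip
    βt = e , β , tail
    βp = e , β , tip

    -- Away from `e` the sides for `C` and `D` coincide, so a labelling constant along the sides for
    -- `C` needs attention for `D` only at the four ends of `e`.
    h-side : ∀ {X : Set} (h : ArrowEnd (edges G) → X) (P : Rel X 0ℓ) → (∀ {x} → P x x) →
      ∀ C D → (∀ {e′} → e′ ≢ e → lookup C e′ ≡ lookup D e′) →
      (∀ x → h x ≡ h (side C x)) → (∀ s → P (h (e , s)) (h (side D (e , s)))) →
      ∀ x → P (h x) (h (side D x))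
    h-side h P rfl C D C≈D sideC at-e (e′ , s) with e′ Fin.≟ e
    ... | yes refl = at-e s
    ... | no  ≢e   = subst (P _)
      (trans (sideC (e′ , s)) (cong h (side-cong C D s (C≈D ≢e)))) rfl

    A-along : ∀ s → side A (e , s) ≡ along (e , s)
    A-along s = side-outside A s (insert-outside ins)

    B-across : ∀ s → side B (e , s) ≡ across (e , s)
    B-across s = side-inside B s (insert-inside ins)

    -- Shaped after the hypothesis of `count-≤-suc`, with classes as values.
    Merges : ∀ {X : Set} → X → X → Rel X 0ℓ
    Merges u v i j = i ≡ j ⊎ (i ≡ u × j ≡ v) ⊎ (i ≡ v × j ≡ u)

    Merges-collapse : ∀ {X : Set} {u v : X} → u ≡ v → ∀ {i j} → Merges u v i j → i ≡ j
    Merges-collapse u≡v (inj₁ eq) = eq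
    Merges-collapse u≡v (inj₂ (inj₁ (i≡ , j≡))) = trans i≡ (trans u≡v (sym j≡))
    Merges-collapse u≡v (inj₂ (inj₂ (i≡ , j≡))) = trans i≡ (trans (sym u≡v) (sym j≡))

    module _ {X : Set} (h : ArrowEnd (edges G) → X) where

      -- For `A` the two ends of each arrow of `e` carry one label, so the new sides of `e`, which
      -- run from one arrow to the other, can only identify the label of α with that of β.
      add-B : (∀ x → h x ≡ h (side A x)) → ∀ x → Merges (h αt) (h βp) (h x) (h (side B x))
      add-B sideA = h-side h (Merges _ _) (inj₁ refl) A B (insert-elsewhere ins) sideA
        λ s → subst (Merges _ _ _ ∘ h) (sym (B-across s)) (at-e s)
        where
        αt~αp : h αt ≡ h αp
        αt~αp = trans (sideA αt) (cong h (A-along _))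
        βt~βp : h βt ≡ h βp
        βt~βp = trans (sideA βt) (cong h (A-along _))
        at-e : ∀ s → Merges (h αt) (h βp) (h (e , s)) (h (across (e , s)))
        at-e (α , tail) = inj₂ (inj₁ (refl , refl))
        at-e (α , tip)  = inj₂ (inj₁ (sym αt~αp , βt~βp))
        at-e (β , tail) = inj₂ (inj₂ (βt~βp , sym αt~αp))
        at-e (β , tip)  = inj₂ (inj₂ (refl , refl))

      -- For `B` the labels agree on `αt`, `βp` and on `αp`, `βt`; both arrows of `e` lead from one
      -- of these pairs to the other.
      add-A : (∀ x → h x ≡ h (side B x)) → ∀ x → Merges (h αt) (h αp) (h x) (h (side A x))
      add-A sideB = h-side h (Merges _ _) (inj₁ refl) B A (λ ≢e → sym (insert-elsewhere ins ≢e)) sideB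
        λ s → subst (Merges _ _ _ ∘ h) (sym (A-along s)) (at-e s)
        where
        αt~βp : h αt ≡ h βp
        αt~βp = trans (sideB αt) (cong h (B-across _))
        αp~βt : h αp ≡ h βt
        αp~βt = trans (sideB αp) (cong h (B-across _))
        at-e : ∀ s → Merges (h αt) (h αp) (h (e , s)) (h (along (e , s)))
        at-e (α , tail) = inj₂ (inj₁ (refl , refl))
        at-e (α , tip)  = inj₂ (inj₂ (refl , refl))
        at-e (β , tail) = inj₂ (inj₂ (sym αp~βt , sym αt~βp))
        at-e (β , tip)  = inj₂ (inj₁ (sym αt~βp , sym αp~βt))

    CA-βt-βp : CA.class (↑ βt) ≡ CA.class (↑ βp)
    CA-βt-βp = move (components G A) (there (here refl)) βt

    FA⇒CA : ∀ {x y} → FA.class x ≡ FA.class y → CA.class x ≡ CA.class y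
    FA⇒CA = class-elim (boundaries G A) CA.class
      (step-class (components G A)
        ( move (components G A) (here refl)
        ∷ move (components G A) (there (there (here refl)))
        ∷ []))

    -- At `e` the side for `A` is `along`, which is itself a generating move for the components of
    -- `B`.
    step-CA⇒CB : ∀ {x y} → Step (List.map map₁ (arc G ∷ along ∷ side A ∷ [])) x y →
                 CB.class x ≡ CB.class y
    step-CA⇒CB = step-class (components G B)
      ( move (components G B) (here refl)
      ∷ move (components G B) (there (here refl))
      ∷ h-side (CB.class ∘ ↑) _≡_ refl B A (λ ≢e → sym (insert-elsewhere ins ≢e))
          (move (components G B) (there (there (here refl))))
          (λ s → subst (λ y → CB.class (↑ (e , s)) ≡ CB.class (↑ y)) (sym (A-along s))
            (move (components G B) (there (here refl)) (e , s)))
      ∷ [])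

    step-CB⇒CA : ∀ {x y} → Step (List.map map₁ (arc G ∷ along ∷ side B ∷ [])) x y →
                 Merges (CA.class (↑ αt)) (CA.class (↑ βp)) (CA.class x) (CA.class y)
    step-CB⇒CA = step-elim (λ x y → Merges _ _ (CA.class x) (CA.class y)) (inj₁ refl)
      ( inj₁ ∘ move (components G A) (here refl)
      ∷ inj₁ ∘ move (components G A) (there (here refl))
      ∷ add-B (CA.class ∘ ↑) (move (components G A) (there (there (here refl))))
      ∷ [])

    step-FA⇒M : ∀ {x y} → Step (List.map map₁ (arc G ∷ side A ∷ [])) x y →
                M.class x ≡ M.class y
    step-FA⇒M = step-class merged
      (move merged (here refl) ∷ move merged (there (here refl)) ∷ [])

    step-M⇒FB : ∀ {x y} → Step (List.map map₁ (arc G ∷ side A ∷ side B ∷ [])) x y →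
                Merges (FB.class (↑ αt)) (FB.class (↑ αp)) (FB.class x) (FB.class y)
    step-M⇒FB = step-elim (λ x y → Merges _ _ (FB.class x) (FB.class y)) (inj₁ refl)
      ( inj₁ ∘ move (boundaries G B) (here refl)
      ∷ add-A (FB.class ∘ ↑) (move (boundaries G B) (there (here refl)))
      ∷ inj₁ ∘ move (boundaries G B) (there (here refl))
      ∷ [])

    -- Otherwise the points of Q would be an even number, being closed under
    -- arc G, and an odd one, as side A fixes no point but pairs up Q ∖ {αt}.
    bridge : CA.class (↑ αt) ≢ CA.class (↑ βp) → FB.class (↑ αt) ≡ FB.class (↑ αp)
    bridge αt≁βp with FB.class (↑ αp) Fin.≟ FB.class (↑ αt)
    ... | yes eq = sym eq
    ... | no αp≁αt = ⊥-elim (involutions-conflict (points G)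
        (map₁-invol (arc-involutive G)) (map₁-invol (side-involutive A)) Q? _≟_ Q-αt
        arc-closed arc-free side-closed side-free)
      where
      map₁-invol : ∀ {ι : ArrowEnd (edges G) → ArrowEnd (edges G)} → (∀ x → ι (ι x) ≡ x) →
                   ∀ (x : Point G) → map₁ ι (map₁ ι x) ≡ x
      map₁-invol invol (inj₁ x) = cong inj₁ (invol x)
      map₁-invol invol (inj₂ i) = refl

      Q : Point G → Set
      Q (inj₁ x) = CA.class (↑ x) ≡ CA.class (↑ αt) × FB.class (↑ x) ≡ FB.class (↑ αt)
      -- Empty circles are fixed by both involutions and would spoil the parity count.
      Q (inj₂ _) = Empty

      Q? : ∀ x → Dec (Q x)
      Q? (inj₁ x) = (CA.class (↑ x) Fin.≟ CA.class (↑ αt))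
              ×-dec (FB.class (↑ x) Fin.≟ FB.class (↑ αt))
      Q? (inj₂ _) = no λ ()

      _≟_ : (x y : Point G) → Dec (x ≡ y)
      _≟_ = Sum.≡-dec (≡-dec Fin._≟_ (≡-dec _≟ᴬ_ _≟ᴱ_)) Fin._≟_

      Q-αt : Q (↑ αt)
      Q-αt = refl , refl

      arc-closed : ∀ {x} → Q x → Q (map₁ (arc G) x)
      arc-closed {inj₁ x} (CAx , FBx) =
        trans (sym (move (components G A) (here refl) x)) CAx ,
        trans (sym (move (boundaries G B) (here refl) x)) FBx

      arc-free : ∀ {x} → Q x → map₁ (arc G) x ≢ x
      arc-free {inj₁ x} _ eq = arc-fixedPtFree G x (Sum.inj₁-injective eq)

      -- Of the four ends of `e` only `αt` lies in `Q`: `αp` is on another boundary component of `B`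
      -- by `αp≁αt`, and the ends of β are in another component of `A` by `αt≁βp`. At other edges
      -- `side A` and `side B` agree, so both conditions of `Q` are preserved.
      side-closed : ∀ {x} → Q x → x ≢ ↑ αt → Q (map₁ (side A) x) × map₁ (side A) x ≢ ↑ αt
      side-closed {inj₁ (e′ , s)} (CAx , FBx) ≢αt with e′ Fin.≟ e
      side-closed {inj₁ (_ , α , tail)} (CAx , FBx) ≢αt | yes refl = contradiction refl ≢αt
      side-closed {inj₁ (_ , α , tip)}  (CAx , FBx) ≢αt | yes refl = contradiction FBx αp≁αt
      side-closed {inj₁ (_ , β , tail)} (CAx , FBx) ≢αt | yes refl =
        contradiction (trans (sym CAx) CA-βt-βp) αt≁βp
      side-closed {inj₁ (_ , β , tip)}  (CAx , FBx) ≢αt | yes refl = contradiction (sym CAx) αt≁βp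
      side-closed {inj₁ (e′ , s)} (CAx , FBx) ≢αt | no ≢e =
        ( trans (sym (move (components G A) (there (there (here refl))) (e′ , s))) CAx
        , trans (cong (FB.class ∘ ↑) (side-cong A B s (insert-elsewhere ins ≢e)))
            (trans (sym (move (boundaries G B) (there (here refl)) (e′ , s))) FBx)) ,
        λ eq → ≢e (trans (sym (side-edge A e′ s)) (cong proj₁ (Sum.inj₁-injective eq)))

      side-free : ∀ {x} → Q x → x ≢ ↑ αt → map₁ (side A) x ≢ x
      side-free {inj₁ x} _ _ eq = side-fixedPtFree A x (Sum.inj₁-injective eq)

  c-insert-≤ : c G B ℕ.≤ c G A
  c-insert-≤ = count-≤ (components G A) (components G B) step-CA⇒CB

  c-insert-≥ : c G A ℕ.≤ suc (c G B)
  c-insert-≥ = count-≤-suc (components G A) (components G B) step-CB⇒CA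

  -- An edge joining different components of A joins different boundary
  -- components; any other edge changes their number by at most one.
  f-insert : f G B ℕ.+ 2 ℕ.* c G A ℕ.≤ suc (2 ℕ.* c G B ℕ.+ f G A)
  f-insert with CA.class (↑ αt) Fin.≟ CA.class (↑ βp)
  ... | yes αt~βp = begin
    f G B ℕ.+ 2 ℕ.* c G A         ≤⟨ ℕ.+-mono-≤ fB≤ (ℕ.*-monoʳ-≤ 2 cA≤) ⟩
    suc (f G A ℕ.+ 2 ℕ.* c G B)   ≡⟨ cong suc (ℕ.+-comm (f G A) _) ⟩
    suc (2 ℕ.* c G B ℕ.+ f G A)   ∎
    where
    open ℕ.≤-Reasoning
    cA≤ : c G A ℕ.≤ c G B
    cA≤ = count-≤ (components G B) (components G A)
      (Merges-collapse αt~βp ∘ step-CB⇒CA)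
    -- The common quotient `merged` has at most `f G A` classes and, by `add-A`, at most one fewer
    -- than the boundaries of `B`.
    fB≤ : f G B ℕ.≤ suc (f G A)
    fB≤ = ℕ.≤-trans (count-≤-suc (boundaries G B) merged step-M⇒FB)
      (s≤s (count-≤ (boundaries G A) merged step-FA⇒M))
  ... | no αt≁βp = begin
    f G B ℕ.+ 2 ℕ.* c G A               ≤⟨ ℕ.+-monoʳ-≤ (f G B) (ℕ.*-monoʳ-≤ 2 c-insert-≥) ⟩
    f G B ℕ.+ 2 ℕ.* suc (c G B)         ≡⟨ solve 2 (λ F C → F :+ con 2 :* (con 1 :+ C)
      := con 1 :+ (con 2 :* C :+ (con 1 :+ F))) refl (f G B) (c G B) ⟩
    suc (2 ℕ.* c G B ℕ.+ suc (f G B))   ≤⟨ s≤s (ℕ.+-monoʳ-≤ (2 ℕ.* c G B) fB<) ⟩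
    suc (2 ℕ.* c G B ℕ.+ f G A)         ∎
    where
    open ℕ.≤-Reasoning
    open +-*-Solver using (solve; _:=_; _:+_; _:*_; con)
    -- By `bridge`, passing from the boundaries of `B` to `merged` identifies nothing. Passing from
    -- those of `A` does identify `αt` and `βp`, which lie in different components and hence on
    -- different boundary components.
    fB< : f G B ℕ.< f G A
    fB< = ℕ.≤-<-trans
      (count-≤ merged (boundaries G B) (Merges-collapse (bridge αt≁βp) ∘ step-M⇒FB))
      (count-< (boundaries G A) merged step-FA⇒M (αt≁βp ∘ FA⇒CA)
        (trans (move merged (there (there (here refl))) αt)
          (cong (M.class ∘ ↑) (B-across _))))

-- Euler genus of spanning ribbon subgraphs, and the exponents

module _ (G : EmbeddedGraph) where

  private
    along≡side : ∀ (x : ArrowEnd (edges G)) → along x ≡ side ∅ x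
    along≡side (e , s) = sym (side-outside ∅ s (lookup-replicate e outside))

    circles-side : ∀ x → Classes.class (circles G) (inj₁ x) ≡
                         Classes.class (circles G) (inj₁ (side ∅ x))
    circles-side x = trans (move (circles G) (there (here refl)) x)
      (cong (Classes.class (circles G) ∘ inj₁) (along≡side x))

    boundaries-along : ∀ x → Classes.class (boundaries G ∅) (inj₁ x) ≡
                             Classes.class (boundaries G ∅) (inj₁ (along x))
    boundaries-along x = trans (move (boundaries G ∅) (there (here refl)) x)
      (cong (Classes.class (boundaries G ∅) ∘ inj₁) (sym (along≡side x)))

  -- `side ∅` is `along`, so circles, components and boundaries for `∅` have the same generating
  -- moves up to repetition.
  c-empty : c G ∅ ≡ vertices G
  c-empty = ℕ.≤-antisym
    (count-≤ (circles G) (components G ∅) (step-class (components G ∅)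
      (move (components G ∅) (here refl) ∷ move (components G ∅) (there (here refl)) ∷ [])))
    (count-≤ (components G ∅) (circles G) (step-class (circles G)
      (move (circles G) (here refl) ∷ move (circles G) (there (here refl)) ∷ circles-side ∷ [])))

  f-empty : f G ∅ ≡ vertices G
  f-empty = ℕ.≤-antisym
    (count-≤ (circles G) (boundaries G ∅) (step-class (boundaries G ∅)
      (move (boundaries G ∅) (here refl) ∷ boundaries-along ∷ [])))
    (count-≤ (boundaries G ∅) (circles G) (step-class (circles G)
      (move (circles G) (here refl) ∷ circles-side ∷ [])))

  open ℕ.≤-Reasoning
  open +-*-Solver using (solve; _:=_; _:+_; _:*_; con)

  c≤vertices : ∀ A → c G A ℕ.≤ vertices G
  c≤vertices A = subst (c G A ℕ.≤_) c-empty
    (from-empty (λ A B → c G B ℕ.≤ c G A) ℕ.≤-refl (λ p q → ℕ.≤-trans q p) (c-insert-≤ G) A)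

  c-full≤c : ∀ A → c G ⊤ ℕ.≤ c G A
  c-full≤c = to-full (λ A B → c G B ℕ.≤ c G A) ℕ.≤-refl (λ p q → ℕ.≤-trans q p) (c-insert-≤ G)

  -- Each inserted edge lowers the number of components by at most one. Hence the subtraction
  -- defining `n` does not truncate.
  vertices≤c+size : ∀ A → vertices G ℕ.≤ c G A ℕ.+ ∣ A ∣
  vertices≤c+size A = begin
    vertices G                ≡⟨ c-empty ⟨
    c G ∅                 ≤⟨ ℕ.m≤m+n _ _ ⟩
    c G ∅ ℕ.+ ∣ ∅ {edges G} ∣    ≤⟨ from-empty (λ A B → c G A ℕ.+ ∣ A ∣ ℕ.≤ c G B ℕ.+ ∣ B ∣)
                                   ℕ.≤-refl ℕ.≤-trans step A ⟩
    c G A ℕ.+ ∣ A ∣           ∎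
    where
    step : ∀ {e A B} → Insert e A B → c G A ℕ.+ ∣ A ∣ ℕ.≤ c G B ℕ.+ ∣ B ∣
    step {A = A} {B} ins = begin
      c G A ℕ.+ ∣ A ∣         ≤⟨ ℕ.+-monoˡ-≤ ∣ A ∣ (c-insert-≥ G ins) ⟩
      suc (c G B) ℕ.+ ∣ A ∣   ≡⟨ ℕ.+-suc (c G B) ∣ A ∣ ⟨
      c G B ℕ.+ suc ∣ A ∣     ≡⟨ cong (c G B ℕ.+_) (insert-size ins) ⟨
      c G B ℕ.+ ∣ B ∣         ∎

  private
    -- The Euler genus of A is at most that of B.
    _≼_ : Rel (Subset (edges G)) 0ℓ
    A ≼ B = f G B ℕ.+ (2 ℕ.* c G A ℕ.+ ∣ A ∣) ℕ.≤ f G A ℕ.+ (2 ℕ.* c G B ℕ.+ ∣ B ∣)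

    -- The genera are compared by cross-addition instead of subtraction, so the two inequalities are
    -- added and the contribution of the middle set is cancelled.
    ≼-trans : ∀ {A B C} → A ≼ B → B ≼ C → A ≼ C
    ≼-trans {A} {B} {C} p q = ℕ.+-cancelʳ-≤ (f G B ℕ.+ g B) _ _ (begin
      f G C ℕ.+ g A ℕ.+ (f G B ℕ.+ g B)   ≡⟨ swap (f G C) (g A) (f G B) (g B) ⟩
      f G C ℕ.+ g B ℕ.+ (f G B ℕ.+ g A)   ≤⟨ ℕ.+-mono-≤ q p ⟩
      f G B ℕ.+ g C ℕ.+ (f G A ℕ.+ g B)   ≡⟨ swap′ (f G B) (g C) (f G A) (g B) ⟩
      f G A ℕ.+ g C ℕ.+ (f G B ℕ.+ g B)   ∎)
      where
      g : Subset (edges G) → ℕ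
      g A = 2 ℕ.* c G A ℕ.+ ∣ A ∣
      swap : ∀ w x y z → w ℕ.+ x ℕ.+ (y ℕ.+ z) ≡ w ℕ.+ z ℕ.+ (y ℕ.+ x)
      swap = solve 4 (λ w x y z → w :+ x :+ (y :+ z) := w :+ z :+ (y :+ x)) refl
      swap′ : ∀ w x y z → w ℕ.+ x ℕ.+ (y ℕ.+ z) ≡ y ℕ.+ x ℕ.+ (w ℕ.+ z)
      swap′ = solve 4 (λ w x y z → w :+ x :+ (y :+ z) := y :+ x :+ (w :+ z)) refl

    ≼-insert : ∀ {e A B} → Insert e A B → A ≼ B
    ≼-insert {A = A} {B} ins = begin
      f G B ℕ.+ (2 ℕ.* c G A ℕ.+ ∣ A ∣)         ≡⟨ ℕ.+-assoc (f G B) _ _ ⟨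
      f G B ℕ.+ 2 ℕ.* c G A ℕ.+ ∣ A ∣           ≤⟨ ℕ.+-monoˡ-≤ ∣ A ∣ (f-insert G ins) ⟩
      suc (2 ℕ.* c G B ℕ.+ f G A) ℕ.+ ∣ A ∣     ≡⟨ solve 3 (λ C F a → con 1 :+ (C :+ F) :+ a
                                                     := F :+ (C :+ (con 1 :+ a))) refl
                                                   (2 ℕ.* c G B) (f G A) ∣ A ∣ ⟩
      f G A ℕ.+ (2 ℕ.* c G B ℕ.+ suc ∣ A ∣)
        ≡⟨ cong (λ t → f G A ℕ.+ (2 ℕ.* c G B ℕ.+ t)) (insert-size ins) ⟨
      f G A ℕ.+ (2 ℕ.* c G B ℕ.+ ∣ B ∣)         ∎

  -- Non-negativity of the Euler genus, which is 0 at `∅`, where `c`, `f` and `vertices` coincide,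
  -- and does not decrease when edges are inserted.
  vertices+f≤ : ∀ A → vertices G ℕ.+ f G A ℕ.≤ 2 ℕ.* c G A ℕ.+ ∣ A ∣
  vertices+f≤ A = ℕ.+-cancelˡ-≤ (vertices G) _ _ (begin
    v ℕ.+ (v ℕ.+ f G A)
      ≡⟨ solve 2 (λ v F → v :+ (v :+ F) := F :+ (con 2 :* v :+ con 0)) refl v (f G A) ⟩
    f G A ℕ.+ (2 ℕ.* v ℕ.+ 0)
      ≡⟨ cong₂ (λ a b → f G A ℕ.+ (2 ℕ.* a ℕ.+ b)) c-empty (∣⊥∣≡0 (edges G)) ⟨
    f G A ℕ.+ (2 ℕ.* c G ∅ ℕ.+ ∣ ∅ {edges G} ∣)
      ≤⟨ from-empty _≼_ ℕ.≤-refl (λ {A} {B} {C} → ≼-trans {A} {B} {C}) ≼-insert A ⟩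
    f G ∅ ℕ.+ (2 ℕ.* c G A ℕ.+ ∣ A ∣)      ≡⟨ cong (ℕ._+ (2 ℕ.* c G A ℕ.+ ∣ A ∣)) f-empty ⟩
    v ℕ.+ (2 ℕ.* c G A ℕ.+ ∣ A ∣)              ∎)
    where v = vertices G

  -- By monotonicity the Euler genus of `A` is at most that of the whole graph, which is 0.
  plane⇒vertices+f≥ : Plane G → ∀ A → 2 ℕ.* c G A ℕ.+ ∣ A ∣ ℕ.≤ vertices G ℕ.+ f G A
  plane⇒vertices+f≥ (_ , genus≡0) A = ℕ.+-cancelˡ-≤ (f G ⊤) _ _ (begin
    f G ⊤ ℕ.+ (2 ℕ.* c G A ℕ.+ ∣ A ∣)
      ≤⟨ to-full _≼_ ℕ.≤-refl (λ {A} {B} {C} → ≼-trans {A} {B} {C}) ≼-insert A ⟩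
    f G A ℕ.+ (2 ℕ.* c G ⊤ ℕ.+ ∣ ⊤ {edges G} ∣)
      ≡⟨ cong (λ t → f G A ℕ.+ (2 ℕ.* c G ⊤ ℕ.+ t)) (∣⊤∣≡n (edges G)) ⟩
    f G A ℕ.+ (2 ℕ.* c G ⊤ ℕ.+ edges G)            ≡⟨ cong (f G A ℕ.+_) genus0 ⟩
    f G A ℕ.+ (vertices G ℕ.+ f G ⊤)
      ≡⟨ solve 3 (λ F v F′ → F :+ (v :+ F′) := F′ :+ (v :+ F)) refl (f G A) (vertices G) (f G ⊤) ⟩
    f G ⊤ ℕ.+ (vertices G ℕ.+ f G A)               ∎)
    where
    genus0 : 2 ℕ.* c G ⊤ ℕ.+ edges G ≡ vertices G ℕ.+ f G ⊤
    genus0 = ℤ.+-injective (rearrange (+ (2 ℕ.* c G ⊤)) (+ vertices G) (+ edges G) (+ f G ⊤) genus≡0)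
      where
      rearrange : ∀ C v e F → C ℤ.- (v ℤ.- e ℤ.+ F) ≡ + 0 → C ℤ.+ e ≡ v ℤ.+ F
      rearrange C v e F eq = trans
        (ℤ-Solver.solve 4 (λ C v e F → C ℤ-Solver.:+ e ℤ-Solver.:=
          (C ℤ-Solver.:- (v ℤ-Solver.:- e ℤ-Solver.:+ F)) ℤ-Solver.:+ (v ℤ-Solver.:+ F)) refl C v e F)
        (trans (cong (ℤ._+ (v ℤ.+ F)) eq) (ℤ.+-identityˡ _))

  module _ (A : Subset (edges G)) where

    c+r : c G A ℕ.+ r G A ≡ vertices G
    c+r = ℕ.m+[n∸m]≡n (c≤vertices A)

    r≤r-full : r G A ℕ.≤ r G ⊤
    r≤r-full = ℕ.∸-monoʳ-≤ (vertices G) (c-full≤c A)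

    r+n : r G A ℕ.+ n G A ≡ ∣ A ∣
    r+n = ℕ.m+[n∸m]≡n (ℕ.m≤n+o⇒m∸n≤o (vertices G) (c G A) (vertices≤c+size A))

    -- Both ranks are taken from the same number of vertices, so the corank of `A` is the excess of
    -- its components over those of `G`.
    c-corank : c G ⊤ ℕ.+ (r G ⊤ ∸ r G A) ≡ c G A
    c-corank = ℕ.+-cancelʳ-≡ (r G A) _ _ (begin-equality
      c G ⊤ ℕ.+ (r G ⊤ ∸ r G A) ℕ.+ r G A     ≡⟨ ℕ.+-assoc (c G ⊤) _ _ ⟩
      c G ⊤ ℕ.+ (r G ⊤ ∸ r G A ℕ.+ r G A)     ≡⟨ cong (c G ⊤ ℕ.+_) (ℕ.m∸n+n≡m r≤r-full) ⟩
      c G ⊤ ℕ.+ r G ⊤                         ≡⟨ ℕ.m+[n∸m]≡n (c≤vertices ⊤) ⟩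
      vertices G                                    ≡⟨ c+r ⟨
      c G A ℕ.+ r G A                               ∎)

    -- Consequently `c + n - f` at `A` is the Euler genus of `A`; this converts the genus estimates
    -- into statements about the exponent of `z`.
    vertices+c+n : vertices G ℕ.+ (c G A ℕ.+ n G A) ≡ 2 ℕ.* c G A ℕ.+ ∣ A ∣
    vertices+c+n = begin-equality
      vertices G ℕ.+ (c G A ℕ.+ n G A)           ≡⟨ cong (ℕ._+ (c G A ℕ.+ n G A)) c+r ⟨
      c G A ℕ.+ r G A ℕ.+ (c G A ℕ.+ n G A)
        ≡⟨ solve 3 (λ c r n → c :+ r :+ (c :+ n) := con 2 :* c :+ (r :+ n)) refl (c G A) (r G A) (n G A) ⟩
      2 ℕ.* c G A ℕ.+ (r G A ℕ.+ n G A)          ≡⟨ cong (2 ℕ.* c G A ℕ.+_) r+n ⟩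
      2 ℕ.* c G A ℕ.+ ∣ A ∣                      ∎

    f≤c+n : f G A ℕ.≤ c G A ℕ.+ n G A
    f≤c+n = ℕ.+-cancelˡ-≤ (vertices G) _ _
      (ℕ.≤-trans (vertices+f≤ A) (ℕ.≤-reflexive (sym vertices+c+n)))

    plane⇒f≡c+n : Plane G → f G A ≡ c G A ℕ.+ n G A
    plane⇒f≡c+n plane = ℕ.≤-antisym f≤c+n (ℕ.+-cancelˡ-≤ (vertices G) _ _
      (ℕ.≤-trans (ℕ.≤-reflexive vertices+c+n) (plane⇒vertices+f≥ plane A)))

-- Signed sums and integer polynomials

-- Formal counterpart of `∑±`: the sum stays an integer polynomial, whose coefficients can be
-- determined over the integers and then used in any ring.
∑±ᴾ : (m : ℕ) → (Subset m → Polynomial) → Polynomial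
∑±ᴾ zero    t = t []
∑±ᴾ (suc m) t = ∑±ᴾ m (t ∘ (outside ∷_)) ⊖ ∑±ᴾ m (t ∘ (inside ∷_))

module SignedSums {a ℓ} (K : CommutativeRing a ℓ) where
  open CommutativeRing K
    renaming (refl to ≈-refl; sym to ≈-sym; trans to ≈-trans)
  open Exp semiring using (_^_)
  open Evaluation K
  open RingProperties ring using (-1*x≈-x; -‿distribʳ-*; x[y-z]≈xy-xz)
  open AbelianGroupProperties +-abelianGroup using (⁻¹-∙-comm; ε⁻¹≈ε; ⁻¹-involutive)
  open CommutativeSemigroupProperties +-commutativeSemigroup using (interchange)
  open import Relation.Binary.Reasoning.Setoid setoid

  -- The sign `(-1)^|A|` is built into the recursion, one minus for each edge inside, so that sums
  -- can be factored edge by edge.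
  ∑± : (m : ℕ) → (Subset m → Carrier) → Carrier
  ∑± zero    t = t []
  ∑± (suc m) t = ∑± m (t ∘ (outside ∷_)) - ∑± m (t ∘ (inside ∷_))

  ∑⊆-cong : ∀ m {s t : Subset m → Carrier} → (∀ A → s A ≈ t A) → ∑⊆ m s ≈ ∑⊆ m t
  ∑⊆-cong zero    eq = eq []
  ∑⊆-cong (suc m) eq = +-cong (∑⊆-cong m (eq ∘ _)) (∑⊆-cong m (eq ∘ _))

  ∑±-cong : ∀ m {s t : Subset m → Carrier} → (∀ A → s A ≈ t A) → ∑± m s ≈ ∑± m t
  ∑±-cong zero    eq = eq []
  ∑±-cong (suc m) eq = +-cong (∑±-cong m (eq ∘ _)) (-‿cong (∑±-cong m (eq ∘ _)))

  ∑⊆-*ˡ : ∀ m x (t : Subset m → Carrier) → ∑⊆ m (λ A → x * t A) ≈ x * ∑⊆ m t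
  ∑⊆-*ˡ zero    x t = ≈-refl
  ∑⊆-*ˡ (suc m) x t = ≈-trans (+-cong (∑⊆-*ˡ m x _) (∑⊆-*ˡ m x _)) (≈-sym (distribˡ x _ _))

  ∑±-*ˡ : ∀ m x (t : Subset m → Carrier) → ∑± m (λ A → x * t A) ≈ x * ∑± m t
  ∑±-*ˡ zero    x t = ≈-refl
  ∑±-*ˡ (suc m) x t = ≈-trans (+-cong (∑±-*ˡ m x _) (-‿cong (∑±-*ˡ m x _))) (≈-sym (x[y-z]≈xy-xz x _ _))

  sub-interchange : ∀ w x y z → (w + x) - (y + z) ≈ (w - y) + (x - z)
  sub-interchange w x y z = ≈-trans (+-congˡ (≈-sym (⁻¹-∙-comm y z))) (interchange w x (- y) (- z))

  ∑±-+ : ∀ m (s t : Subset m → Carrier) → ∑± m (λ A → s A + t A) ≈ ∑± m s + ∑± m t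
  ∑±-+ zero    s t = ≈-refl
  ∑±-+ (suc m) s t = ≈-trans (+-cong (∑±-+ m _ _) (-‿cong (∑±-+ m _ _))) (sub-interchange _ _ _ _)

  ∑⊆-signed : ∀ m (t : Subset m → Carrier) → ∑⊆ m (λ A → (- 1#) ^ ∣ A ∣ * t A) ≈ ∑± m t
  ∑⊆-signed zero    t = *-identityˡ _
  ∑⊆-signed (suc m) t = +-cong (∑⊆-signed m _) (begin
    ∑⊆ m (λ A → (- 1# * (- 1#) ^ ∣ A ∣) * t (inside ∷ A))
      ≈⟨ ∑⊆-cong m (λ A → *-assoc _ _ _) ⟩
    ∑⊆ m (λ A → - 1# * ((- 1#) ^ ∣ A ∣ * t (inside ∷ A)))
      ≈⟨ ∑⊆-*ˡ m (- 1#) _ ⟩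
    - 1# * ∑⊆ m (λ A → (- 1#) ^ ∣ A ∣ * t (inside ∷ A))
      ≈⟨ -1*x≈-x _ ⟩
    - ∑⊆ m (λ A → (- 1#) ^ ∣ A ∣ * t (inside ∷ A))
      ≈⟨ -‿cong (∑⊆-signed m _) ⟩
    - ∑± m (t ∘ (inside ∷_)) ∎)

  -- Evaluation of integer polynomials in a commutative ring

  open MonoidMult +-monoid using (×-homo-+) renaming (_×_ to _·_)

  fromℤ-neg : ∀ i → fromℤ (ℤ.- i) ≈ - fromℤ i
  fromℤ-neg (+ zero)  = ≈-sym ε⁻¹≈ε
  fromℤ-neg (+ suc n) = ≈-refl
  fromℤ-neg -[1+ n ]  = ≈-sym (⁻¹-involutive _)

  fromℤ-⊖ : ∀ m n → fromℤ (m ℤ.⊖ n) ≈ m · 1# - n · 1#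
  fromℤ-⊖ zero    zero    = ≈-sym (-‿inverseʳ 0#)
  fromℤ-⊖ (suc m) zero    = ≈-sym (≈-trans (+-congˡ ε⁻¹≈ε) (+-identityʳ _))
  fromℤ-⊖ zero    (suc n) = ≈-sym (+-identityˡ _)
  fromℤ-⊖ (suc m) (suc n) = begin
    fromℤ (suc m ℤ.⊖ suc n)           ≡⟨ cong fromℤ (ℤ.[1+m]⊖[1+n]≡m⊖n m n) ⟩
    fromℤ (m ℤ.⊖ n)                   ≈⟨ fromℤ-⊖ m n ⟩
    m · 1# - n · 1#                   ≈⟨ +-identityˡ _ ⟨
    0# + (m · 1# - n · 1#)            ≈⟨ +-congʳ (-‿inverseʳ 1#) ⟨
    (1# - 1#) + (m · 1# - n · 1#)     ≈⟨ sub-interchange _ _ _ _ ⟨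
    suc m · 1# - suc n · 1#           ∎

  fromℤ-+ : ∀ i j → fromℤ (i ℤ.+ j) ≈ fromℤ i + fromℤ j
  fromℤ-+ (+ m)    (+ n)    = ×-homo-+ 1# m n
  fromℤ-+ (+ m)    -[1+ n ] = fromℤ-⊖ m (suc n)
  fromℤ-+ -[1+ m ] (+ n)    = ≈-trans (fromℤ-⊖ n (suc m)) (+-comm _ _)
  fromℤ-+ -[1+ m ] -[1+ n ] = begin
    - (suc (suc (m ℕ.+ n)) · 1#)      ≡⟨ cong (λ k → - (k · 1#)) (ℕ.+-suc (suc m) n) ⟨
    - ((suc m ℕ.+ suc n) · 1#)        ≈⟨ -‿cong (×-homo-+ 1# (suc m) (suc n)) ⟩
    - (suc m · 1# + suc n · 1#)       ≈⟨ ⁻¹-∙-comm _ _ ⟨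
    - (suc m · 1#) + - (suc n · 1#)   ∎

  fromℤ-sub : ∀ i j → fromℤ (i ℤ.- j) ≈ fromℤ i - fromℤ j
  fromℤ-sub i j = ≈-trans (fromℤ-+ i (ℤ.- j)) (+-congˡ (fromℤ-neg j))

  eval-negate : ∀ p x → eval (negate p) x ≈ - eval p x
  eval-negate []      x = ≈-sym ε⁻¹≈ε
  eval-negate (a ∷ p) x = begin
    fromℤ (ℤ.- a) + x * eval (negate p) x   ≈⟨ +-cong (fromℤ-neg a) (*-congˡ (eval-negate p x)) ⟩
    - fromℤ a + x * - eval p x              ≈⟨ +-congˡ (-‿distribʳ-* x _) ⟨
    - fromℤ a + - (x * eval p x)            ≈⟨ ⁻¹-∙-comm _ _ ⟩
    - (fromℤ a + x * eval p x)              ∎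

  eval-⊖ : ∀ p q x → eval (p ⊖ q) x ≈ eval p x - eval q x
  eval-⊖ []      q       x = ≈-trans (eval-negate q x) (≈-sym (+-identityˡ _))
  eval-⊖ (a ∷ p) []      x = ≈-sym (≈-trans (+-congˡ ε⁻¹≈ε) (+-identityʳ _))
  eval-⊖ (a ∷ p) (b ∷ q) x = begin
    fromℤ (a ℤ.- b) + x * eval (p ⊖ q) x
      ≈⟨ +-cong (fromℤ-sub a b) (*-congˡ (eval-⊖ p q x)) ⟩
    (fromℤ a - fromℤ b) + x * (eval p x - eval q x)
      ≈⟨ +-congˡ (x[y-z]≈xy-xz x _ _) ⟩
    (fromℤ a - fromℤ b) + (x * eval p x - x * eval q x)
      ≈⟨ sub-interchange _ _ _ _ ⟨
    eval (a ∷ p) x - eval (b ∷ q) x ∎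

  eval-∑±ᴾ : ∀ m (p : Subset m → Polynomial) x →
             eval (∑±ᴾ m p) x ≈ ∑± m (λ A → eval (p A) x)
  eval-∑±ᴾ zero    p x = ≈-refl
  eval-∑±ᴾ (suc m) p x = ≈-trans (eval-⊖ (∑±ᴾ m _) (∑±ᴾ m _) x)
    (+-cong (eval-∑±ᴾ m _ x) (-‿cong (eval-∑±ᴾ m _ x)))

  eval-X^ : ∀ d x → eval (X^ d) x ≈ x ^ d
  eval-X^ zero    x = begin
    (1# + 0#) + x * 0#   ≈⟨ +-cong (+-identityʳ 1#) (zeroʳ x) ⟩
    1# + 0#              ≈⟨ +-identityʳ 1# ⟩
    1#                   ∎
  eval-X^ (suc d) x = ≈-trans (+-identityˡ _) (*-congˡ (eval-X^ d x))

  eval-zero : ∀ {p} → All (_≡ + 0) p → ∀ x → eval p x ≈ 0#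
  eval-zero []            x = ≈-refl
  eval-zero {_ ∷ p} (refl ∷ p≡0) x = begin
    0# + x * eval p x   ≈⟨ +-identityˡ _ ⟩
    x * eval p x        ≈⟨ *-congˡ (eval-zero p≡0 x) ⟩
    x * 0#              ≈⟨ zeroʳ x ⟩
    0#                  ∎

-- Integer polynomials vanishing at all positive integers

open Evaluation ℤ.+-*-commutativeRing using () renaming (eval to evalℤ)

-- Once the constant term is known to be zero, the factor `+ suc k`, being nonzero, cancels, and the
-- remaining polynomial satisfies the same hypothesis. The conclusion concerns coefficients because
-- lists may have trailing zeros.
vanishing⇒zero : ∀ p → (∀ k → evalℤ p (+ suc k) ≡ + 0) → All (_≡ + 0) p
vanishing⇒zero []      van = []
vanishing⇒zero (a ∷ p) van = a≡0 ∷ vanishing⇒zero p van′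
  where
  van-at : ∀ k → a ℤ.+ + suc k ℤ.* evalℤ p (+ suc k) ≡ + 0
  van-at k = trans (sym (DeletionContraction.eval-∷ a p (+ suc k))) (van k)

  -- Every positive k divides a, in particular k = 1 + ∣ a ∣.
  a≡0 : a ≡ + 0
  a≡0 = ℤ.∣i∣≡0⇒i≡0 (∣<⇒0 (ℕ.divides ℤ.∣ q ∣ (begin
    ℤ.∣ a ∣
      ≡⟨ cong ℤ.∣_∣ (ℤ.i-j≡0⇒i≡j a _ (trans (cong (ℤ._+_ a) (ℤ.neg-involutive _)) (van-at ℤ.∣ a ∣))) ⟩
    ℤ.∣ ℤ.- (+ k ℤ.* q) ∣        ≡⟨ ℤ.∣-i∣≡∣i∣ (+ k ℤ.* q) ⟩
    ℤ.∣ + k ℤ.* q ∣              ≡⟨ ℤ.∣i*j∣≡∣i∣*∣j∣ (+ k) q ⟩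
    k ℕ.* ℤ.∣ q ∣                ≡⟨ ℕ.*-comm k _ ⟩
    ℤ.∣ q ∣ ℕ.* k                ∎)))
    where
    open ≡-Reasoning
    k = suc ℤ.∣ a ∣
    q = evalℤ p (+ k)
    ∣<⇒0 : ∀ {i} → suc i ℕ.∣ i → i ≡ 0
    ∣<⇒0 {zero}  _ = refl
    ∣<⇒0 {suc i} d = contradiction (ℕ.∣⇒≤ d) ℕ.1+n≰n

  van′ : ∀ k → evalℤ p (+ suc k) ≡ + 0
  van′ k = ℤ.*-cancelˡ-≡ (+ suc k) _ _ (begin
    + suc k ℤ.* evalℤ p (+ suc k)          ≡⟨ ℤ.+-identityˡ _ ⟨
    + 0 ℤ.+ + suc k ℤ.* evalℤ p (+ suc k)  ≡⟨ cong (ℤ._+ _) a≡0 ⟨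
    a ℤ.+ + suc k ℤ.* evalℤ p (+ suc k)    ≡⟨ van-at k ⟩
    + 0                                    ≡⟨ ℤ.*-zeroʳ (+ suc k) ⟨
    + suc k ℤ.* + 0                        ∎)
    where open ≡-Reasoning

-- Colourings of the points

open SignedSums ℤ.+-*-commutativeRing using ()
  renaming ( ∑± to ∑±ℤ; ∑±-cong to ∑±ℤ-cong; ∑±-+ to ∑±ℤ-+; ∑±-*ˡ to ∑±ℤ-*ˡ
           ; eval-∑±ᴾ to evalℤ-∑±ᴾ)

-- Indicators, and signed sums that factor over the edges

ind : ∀ {P : Set} → Dec P → ℤ
ind P? = if does P? then + 1 else + 0

ind-⇔ : ∀ {P Q : Set} → P ⇔ Q → (P? : Dec P) (Q? : Dec Q) → ind P? ≡ ind Q?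
ind-⇔ P⇔Q P? Q? = cong (if_then + 1 else + 0) (does-⇔ P⇔Q P? Q?)

ind-× : ∀ {P Q : Set} (P? : Dec P) (Q? : Dec Q) → ind (P? ×-dec Q?) ≡ ind P? ℤ.* ind Q?
ind-× (yes _) Q? = sym (ℤ.*-identityˡ (ind Q?))
ind-× (no _)  Q? = refl

module _ {A : Set} where

  length-filter-∷ : ∀ {P : A → Set} (P? : ∀ x → Dec (P x)) x xs →
    + length (filter P? (x ∷ xs)) ≡ ind (P? x) ℤ.+ + length (filter P? xs)
  length-filter-∷ P? x xs with P? x
  ... | yes _ = refl
  ... | no _  = refl

  -- Exchanging the signed sum with the count reduces the comparison to one list element at a time.
  ∑±ℤ-length-filter : ∀ m {P Q : Subset m → A → Set}
    (P? : ∀ S x → Dec (P S x)) (Q? : ∀ S x → Dec (Q S x)) →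
    (∀ x → ∑±ℤ m (λ S → ind (P? S x)) ≡ ∑±ℤ m (λ S → ind (Q? S x))) → ∀ xs →
    ∑±ℤ m (λ S → + length (filter (P? S) xs)) ≡ ∑±ℤ m (λ S → + length (filter (Q? S) xs))
  ∑±ℤ-length-filter m P? Q? eq []       = refl
  ∑±ℤ-length-filter m P? Q? eq (x ∷ xs) = begin
    ∑±ℤ m (λ S → + length (filter (P? S) (x ∷ xs)))
      ≡⟨ ∑±ℤ-cong m (λ S → length-filter-∷ (P? S) x xs) ⟩
    ∑±ℤ m (λ S → ind (P? S x) ℤ.+ + length (filter (P? S) xs))
      ≡⟨ ∑±ℤ-+ m _ _ ⟩
    ∑±ℤ m (λ S → ind (P? S x)) ℤ.+ ∑±ℤ m (λ S → + length (filter (P? S) xs))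
      ≡⟨ cong₂ ℤ._+_ (eq x) (∑±ℤ-length-filter m P? Q? eq xs) ⟩
    ∑±ℤ m (λ S → ind (Q? S x)) ℤ.+ ∑±ℤ m (λ S → + length (filter (Q? S) xs))
      ≡⟨ ∑±ℤ-+ m _ _ ⟨
    ∑±ℤ m (λ S → ind (Q? S x) ℤ.+ + length (filter (Q? S) xs))
      ≡⟨ ∑±ℤ-cong m (λ S → length-filter-∷ (Q? S) x xs) ⟨
    ∑±ℤ m (λ S → + length (filter (Q? S) (x ∷ xs))) ∎
    where open ≡-Reasoning

∏ : ∀ {m} → (Fin m → ℤ) → ℤ
∏ {zero}  t = + 1
∏ {suc m} t = t zero ℤ.* ∏ (t ∘ suc)

∏-cong : ∀ {m} {s t : Fin m → ℤ} → (∀ e → s e ≡ t e) → ∏ s ≡ ∏ t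
∏-cong {zero}  eq = refl
∏-cong {suc m} eq = cong₂ ℤ._*_ (eq zero) (∏-cong (eq ∘ suc))

-- Expansion of a product of differences: choosing the subtracted term at exactly the edges of `A`
-- yields the sign `(-1)^|A|`.
∑±ℤ-∏ : ∀ m (l : Fin m → Bool → ℤ) →
       ∑±ℤ m (λ A → ∏ (λ e → l e (lookup A e))) ≡ ∏ (λ e → l e outside ℤ.- l e inside)
∑±ℤ-∏ zero    l = refl
∑±ℤ-∏ (suc m) l = begin
  ∑±ℤ m (λ A → l zero outside ℤ.* ∏ (λ e → l (suc e) (lookup A e)))
    ℤ.- ∑±ℤ m (λ A → l zero inside ℤ.* ∏ (λ e → l (suc e) (lookup A e)))
    ≡⟨ cong₂ ℤ._-_ (∑±ℤ-*ˡ m (l zero outside) _) (∑±ℤ-*ˡ m (l zero inside) _) ⟩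
  l zero outside ℤ.* rest ℤ.- l zero inside ℤ.* rest
    ≡⟨ [y-z]x≈yx-zx rest (l zero outside) (l zero inside) ⟨
  (l zero outside ℤ.- l zero inside) ℤ.* rest
    ≡⟨ cong ((l zero outside ℤ.- l zero inside) ℤ.*_) (∑±ℤ-∏ m (l ∘ suc)) ⟩
  (l zero outside ℤ.- l zero inside) ℤ.* ∏ (λ e → l (suc e) outside ℤ.- l (suc e) inside) ∎
  where
  open ≡-Reasoning
  open import Algebra.Properties.Ring ℤ.+-*-ring using ([y-z]x≈yx-zx)
  rest = ∑±ℤ m (λ A → ∏ (λ e → l (suc e) (lookup A e)))

ind-all : ∀ {m} {P : Fin m → Set} (P? : ∀ e → Dec (P e)) →
          ind (Fin.all? P?) ≡ ∏ (λ e → ind (P? e))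
ind-all {zero}  P? = refl
ind-all {suc m} P? = begin
  ind (Fin.all? P?)
    ≡⟨ ind-⇔ (mk⇔ (λ p → p zero , p ∘ suc) (λ { (p , q) zero → p ; (p , q) (suc e) → q e }))
         (Fin.all? P?) (P? zero ×-dec Fin.all? (P? ∘ suc)) ⟩
  ind (P? zero ×-dec Fin.all? (P? ∘ suc))
    ≡⟨ ind-× (P? zero) (Fin.all? (P? ∘ suc)) ⟩
  ind (P? zero) ℤ.* ind (Fin.all? (P? ∘ suc))
    ≡⟨ cong (ind (P? zero) ℤ.*_) (ind-all (P? ∘ suc)) ⟩
  ind (P? zero) ℤ.* ∏ (λ e → ind (P? (suc e))) ∎
  where open ≡-Reasoning

module _ {Z : Set} (Z? : Dec Z) (m : ℕ) where

  -- The condition `Z` does not depend on `A`, and the condition at `e` depends only on whether `e`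
  -- belongs to `A`.
  ∑±ℤ-local : ∀ {L : Fin m → Bool → Set} (L? : ∀ e b → Dec (L e b)) →
    ∑±ℤ m (λ A → ind (Z? ×-dec Fin.all? (λ e → L? e (lookup A e)))) ≡
    ind Z? ℤ.* ∏ (λ e → ind (L? e outside) ℤ.- ind (L? e inside))
  ∑±ℤ-local L? = begin
    ∑±ℤ m (λ A → ind (Z? ×-dec Fin.all? (λ e → L? e (lookup A e))))
      ≡⟨ ∑±ℤ-cong m (λ A → trans (ind-× Z? (Fin.all? (λ e → L? e (lookup A e))))
           (cong (ind Z? ℤ.*_) (ind-all (λ e → L? e (lookup A e))))) ⟩
    ∑±ℤ m (λ A → ind Z? ℤ.* ∏ (λ e → ind (L? e (lookup A e))))
      ≡⟨ ∑±ℤ-*ˡ m (ind Z?) _ ⟩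
    ind Z? ℤ.* ∑±ℤ m (λ A → ∏ (λ e → ind (L? e (lookup A e))))
      ≡⟨ cong (ind Z? ℤ.*_) (∑±ℤ-∏ m (λ e b → ind (L? e b))) ⟩
    ind Z? ℤ.* ∏ (λ e → ind (L? e outside) ℤ.- ind (L? e inside)) ∎
    where open ≡-Reasoning

-- Colourings of classes as colourings of points

module _ {A : Set} {N : ℕ} (A↔N : A ↔ Fin N) (k : ℕ) where
  open Inverse A↔N

  colour : Fin (k ℕ.^ N) → A → Fin k
  colour j x = finToFun {k} {N} j (to x)

  -- Colourings of the classes are colourings of the points that are
  -- constant on classes.
  count-colourings : ∀ {_~_ : Rel A 0ℓ} (C : Classes _~_) → let open Classes C in
    {P : Fin (k ℕ.^ count) → Set} (P? : ∀ i → Dec (P i))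
    {Q : Fin (k ℕ.^ N) → Set} (Q? : ∀ j → Dec (Q j)) →
    (∀ {i j} → (∀ x → finToFun {k} {count} i (class x) ≡ colour j x) → P i ⇔ Q j) →
    (∀ {j} → Q j → ∀ {x y} → x ~ y → colour j x ≡ colour j y) →
    length (filter P? (allFin (k ℕ.^ count))) ≡ length (filter Q? (allFin (k ℕ.^ N)))
  count-colourings C {P} P? {Q} Q? P⇔Q resp = sym (trans
    (↭-length (∼bag⇒↭ (unique∧set⇒bag
      (filter⁺ Q? (allFin⁺ _)) (map⁺ pull-injective (filter⁺ P? (allFin⁺ _))) (mk⇔ to′ from′))))
    (length-map pull (filter P? (allFin (k ℕ.^ count)))))
    where
    open Classes C
    colour′ : Fin (k ℕ.^ count) → Fin count → Fin k
    colour′ = finToFun {k} {count}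

    pull : Fin (k ℕ.^ count) → Fin (k ℕ.^ N)
    pull i = funToFin {N} {k} (colour′ i ∘ class ∘ from)

    colour-pull : ∀ i x → colour′ i (class x) ≡ colour (pull i) x
    colour-pull i x = sym (trans (Fin.finToFun-funToFin {N} {k} _ (to x))
      (cong (colour′ i ∘ class) (strictlyInverseʳ x)))

    pull-injective : ∀ {i j} → pull i ≡ pull j → i ≡ j
    pull-injective {i} {j} eq = begin
      i                          ≡⟨ Fin.funToFin-finToFin {count} {k} i ⟨
      funToFin (colour′ i)       ≡⟨ funToFin-cong same ⟩
      funToFin (colour′ j)       ≡⟨ Fin.funToFin-finToFin {count} {k} j ⟩
      j                          ∎
      where
      open ≡-Reasoning
      same : ∀ q → colour′ i q ≡ colour′ j q
      same q = begin
        colour′ i q                    ≡⟨ cong (colour′ i) (class-rep C q) ⟨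
        colour′ i (class (rep C q))    ≡⟨ colour-pull i _ ⟩
        colour (pull i) (rep C q)      ≡⟨ cong (λ t → colour t (rep C q)) eq ⟩
        colour (pull j) (rep C q)      ≡⟨ colour-pull j _ ⟨
        colour′ j (class (rep C q))    ≡⟨ cong (colour′ j) (class-rep C q) ⟩
        colour′ j q                    ∎

    pull-surjective : ∀ {j} → Q j → ∃ λ i → P i × j ≡ pull i
    pull-surjective {j} q = i , Equivalence.from (P⇔Q on-class) q , (begin
      j                                    ≡⟨ Fin.funToFin-finToFin {N} {k} j ⟨
      funToFin (finToFun {k} {N} j)        ≡⟨ funToFin-cong (λ x → trans
        (cong (finToFun {k} {N} j) (sym (strictlyInverseˡ x))) (sym (on-class (from x)))) ⟩
      pull i                               ∎)
      where
      open ≡-Reasoning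
      -- A class receives the colour of its representative; by `resp` all its members have that
      -- colour.
      i = funToFin {count} {k} (colour j ∘ rep C)
      on-class : ∀ x → colour′ i (class x) ≡ colour j x
      on-class x = trans (Fin.finToFun-funToFin {count} {k} _ (class x))
        (class-elim C (colour j) (resp q) (class-rep C (class x)))

    to′ : ∀ {j} → j ∈ filter Q? (allFin (k ℕ.^ N)) →
          j ∈ List.map pull (filter P? (allFin (k ℕ.^ count)))
    to′ j∈ with pull-surjective (proj₂ (∈-filter⁻ Q? {xs = allFin (k ℕ.^ N)} j∈))
    ... | i , p , refl = ∈-map⁺ pull (∈-filter⁺ P? (∈-allFin i) p)

    from′ : ∀ {j} → j ∈ List.map pull (filter P? (allFin (k ℕ.^ count))) →
            j ∈ filter Q? (allFin (k ℕ.^ N))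
    from′ j∈ with ∈-map⁻ pull j∈
    ... | i , i∈ , refl = ∈-filter⁺ Q? (∈-allFin _)
      (Equivalence.to (P⇔Q (colour-pull i)) (proj₂ (∈-filter⁻ P? {xs = allFin (k ℕ.^ count)} i∈)))

-- Colourings at a single edge

ind-false : ∀ {P : Set} (P? : Dec P) → ¬ P → ind P? ≡ + 0
ind-false (yes p) ¬p = contradiction p ¬p
ind-false (no _)  ¬p = refl

-- `side` at one edge, with membership as a parameter: `side A (e , s)` unfolds to
-- `flank (lookup A e) (e , s)`.
flank : ∀ {m} → Bool → ArrowEnd m → ArrowEnd m
flank b x = if b then across x else along x

-- The end of an arrow of G where partialDual (when b holds) followed by
-- petrieDual places a given end of the new arrow.
newEnd : Bool → Arrow × End → Arrow × End
newEnd b = Inverse.to (if b then dualArrows else ↔-id _) ∘ Inverse.to reverseβ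

module _ {m : ℕ} {X : Set} (h : ArrowEnd m → X) (e : Fin m) where

  -- Both pairings match tails with tips, so the two pairs containing the tails exhaust the four
  -- ends.
  Smooth : Bool → Set
  Smooth b = h (e , α , tail) ≡ h (flank b (e , α , tail))
           × h (e , β , tail) ≡ h (flank b (e , β , tail))

  -- Each pair contains exactly one tail, so comparing the tails compares the colours of the two
  -- pairs.
  Split : Bool → Set
  Split b = Smooth b × h (e , α , tail) ≢ h (e , β , tail)

  Smooth⇒flank : ∀ b → Smooth b → ∀ s → h (e , s) ≡ h (flank b (e , s))
  Smooth⇒flank b       (p , q) (α , tail) = p
  Smooth⇒flank b       (p , q) (β , tail) = q
  Smooth⇒flank inside  (p , q) (α , tip)  = sym q
  Smooth⇒flank inside  (p , q) (β , tip)  = sym p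
  Smooth⇒flank outside (p , q) (α , tip)  = sym p
  Smooth⇒flank outside (p , q) (β , tip)  = sym q

  -- The new arrows occupy exactly the pairs of ends matched by `flank b`: the old arrows when `b`
  -- is `outside`, and the segments drawn between α and β when it is `inside`. Reversing β exchanges
  -- the ends within its pair. Thus smoothness says that the new arrows are monochromatic, and the
  -- inequality says that the new edge is properly coloured.
  split-new : ∀ b → Split b ⇔
    ( (∀ a → h (e , newEnd b (a , tail)) ≡ h (e , newEnd b (a , tip)))
    × h (e , newEnd b (α , tail)) ≢ h (e , newEnd b (β , tail)))
  split-new outside = mk⇔
    (λ { ((p , q) , α≢β) → (λ { α → p ; β → sym q }) , λ α≡β → α≢β (trans α≡β (sym q)) })
    (λ { (p , α≢β) → (p α , sym (p β)) , λ α≡β → α≢β (trans α≡β (sym (p β))) })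
  split-new inside = mk⇔
    (λ { ((p , q) , α≢β) → (λ { α → sym q ; β → p }) , λ α≡β → α≢β (sym (trans q α≡β)) })
    (λ { (p , α≢β) → (p β , sym (p α)) , λ α≡β → α≢β (trans (p α) (sym α≡β)) })

  module _ (_≟_ : (x y : X) → Dec (x ≡ y)) where

    Smooth? : ∀ b → Dec (Smooth b)
    Smooth? b = (_ ≟ _) ×-dec (_ ≟ _)

    Split? : ∀ b → Dec (Split b)
    Split? b = Smooth? b ×-dec ¬? (_ ≟ _)

    -- If α and β have tails of the same colour, then smoothness in either way
    -- means that all four ends have it, so that the two terms cancel.
    smooth-split : ind (Smooth? outside) ℤ.- ind (Smooth? inside) ≡
                   ind (Split? outside) ℤ.- ind (Split? inside)
    smooth-split = by-cases (h (e , α , tail) ≟ h (e , β , tail))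
      where
      agree : h (e , α , tail) ≢ h (e , β , tail) → ∀ b → ind (Smooth? b) ≡ ind (Split? b)
      agree α≢β b = ind-⇔ (mk⇔ (_, α≢β) proj₁) (Smooth? b) (Split? b)

      module _ (α≡β : h (e , α , tail) ≡ h (e , β , tail)) where

        swap : ∀ {x y} → h (e , α , tail) ≡ x × h (e , β , tail) ≡ y →
               h (e , α , tail) ≡ y × h (e , β , tail) ≡ x
        swap (p , q) = trans α≡β q , trans (sym α≡β) p

        unsplit : ∀ b → ind (Split? b) ≡ + 0
        unsplit b = ind-false (Split? b) λ s → proj₂ s α≡β

      by-cases : Dec (h (e , α , tail) ≡ h (e , β , tail)) →
                 ind (Smooth? outside) ℤ.- ind (Smooth? inside) ≡
                 ind (Split? outside) ℤ.- ind (Split? inside)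
      by-cases (no α≢β)  = cong₂ ℤ._-_ (agree α≢β outside) (agree α≢β inside)
      by-cases (yes α≡β) = trans
        (ℤ.i≡j⇒i-j≡0 (ind-⇔ (mk⇔ (swap α≡β) (swap α≡β)) (Smooth? outside) (Smooth? inside)))
        (sym (cong₂ ℤ._-_ (unsplit α≡β outside) (unsplit α≡β inside)))

-- Counting colourings of boundary components and of circles

module _ (G : EmbeddedGraph) (k : ℕ) where

  private
    M : ℕ
    M = k ℕ.^ (edges G ℕ.* 4 ℕ.+ emptyCircles G)

    κ : Fin M → Point G → Fin k
    κ = colour (points G) k

    h : Fin M → ArrowEnd (edges G) → Fin k
    h j = κ j ∘ inj₁

    -- Quantification over indices of points makes this decidable by all?.
    OnArcs : Fin M → Set
    OnArcs j = ∀ i → let x = Inverse.from (points G) i in κ j x ≡ κ j (map₁ (arc G) x)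

    OnArcs? : ∀ j → Dec (OnArcs j)
    OnArcs? j = Fin.all? λ i → _ Fin.≟ _

    onArcs⇒ : ∀ {j} → OnArcs j → ∀ x → h j x ≡ h j (arc G x)
    onArcs⇒ {j} on x = subst (λ y → κ j y ≡ κ j (map₁ (arc G) y))
      (Inverse.strictlyInverseʳ (points G) (inj₁ x)) (on (Inverse.to (points G) (inj₁ x)))

    onArcs⇐ : ∀ {j} → (∀ x → h j x ≡ h j (arc G x)) → OnArcs j
    onArcs⇐ on i with Inverse.from (points G) i
    ... | inj₁ x = on x
    ... | inj₂ _ = refl

    Smooths? : ∀ A j → Dec (OnArcs j × ∀ e → Smooth (h j) e (lookup A e))
    Smooths? A j = OnArcs? j ×-dec Fin.all? λ e → Smooth? (h j) e Fin._≟_ (lookup A e)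

    Splits? : ∀ A j → Dec (OnArcs j × ∀ e → Split (h j) e (lookup A e))
    Splits? A j = OnArcs? j ×-dec Fin.all? λ e → Split? (h j) e Fin._≟_ (lookup A e)

  module _ (A : Subset (edges G)) where

    -- The power counts all colourings of the boundary components. Pulled back to points, these are
    -- the colourings constant along the generating moves `arc G` and `side A`.
    count-smooth : k ℕ.^ f G A ≡ length (filter (Smooths? A) (allFin M))
    count-smooth = trans
      (sym (trans
        (cong length (filter-all {P = λ _ → Unit} (λ _ → yes tt)
          (All.universal (λ _ → tt) (allFin (k ℕ.^ f G A)))))
        (length-tabulate (id {A = Fin (k ℕ.^ f G A)}))))
      (count-colourings (points G) k (boundaries G A) {λ _ → Unit} (λ _ → yes tt) (Smooths? A)
        (λ {i} {j} eq → mk⇔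
          (λ _ → onArcs⇐ (constant eq (here refl))
               , λ e → constant eq (there (here refl)) _ , constant eq (there (here refl)) _)
          (λ _ → tt))
        (λ {j} (on , smooth) → step-elim (λ x y → κ j x ≡ κ j y) refl
          ( onArcs⇒ {j} on
          ∷ (λ { (e , s) → Smooth⇒flank (h j) e (lookup A e) (smooth e) s })
          ∷ [])))
      where
      constant : ∀ {i j} → (∀ x → finToFun {k} {f G A} i (Classes.class (boundaries G A) x) ≡ κ j x) →
                 ∀ {m} → m ∈ arc G ∷ side A ∷ [] → ∀ x → h j x ≡ h j (m x)
      constant {i} eq m∈ x = trans (sym (eq _))
        (trans (cong (finToFun {k} {f G A} i) (move (boundaries G A) m∈ x)) (eq _))

    private
      H : EmbeddedGraph
      H = petrieDual (partialDual G A)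

      -- The placements of the two redrawings composed, so that `arc H x` unfolds to
      -- `unplace (arc G (place x))`.
      place unplace : ArrowEnd (edges G) → ArrowEnd (edges G)
      place   (e , s) = e , newEnd (lookup A e) s
      unplace (e , s) = e , Inverse.from reverseβ (Inverse.from (if lookup A e then dualArrows else ↔-id _) s)

      place-unplace : ∀ x → place (unplace x) ≡ x
      place-unplace (e , s) = cong (e ,_) (trans
        (cong (Inverse.to φ) (Inverse.strictlyInverseˡ reverseβ _)) (Inverse.strictlyInverseˡ φ s))
        where φ = if lookup A e then dualArrows else ↔-id _

      unplace-place : ∀ x → unplace (place x) ≡ x
      unplace-place (e , s) = cong (e ,_) (trans
        (cong (Inverse.from reverseβ) (Inverse.strictlyInverseʳ φ _)) (Inverse.strictlyInverseʳ reverseβ s))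
        where φ = if lookup A e then dualArrows else ↔-id _

      placed : Point H ↔ Point G
      placed = mk↔ₛ′ (map₁ place) (map₁ unplace)
        (λ { (inj₁ x) → cong inj₁ (place-unplace x) ; (inj₂ _) → refl })
        (λ { (inj₁ x) → cong inj₁ (unplace-place x) ; (inj₂ _) → refl })

    -- Under `place` the arcs of `H` become those of `G`, and `split-new` translates the conditions
    -- on the arrows and on the edges of `H`.
    count-split : properColourings (underlyingGraph H) k ≡ length (filter (Splits? A) (allFin M))
    -- Indexing the points of `H` through those of `G` makes this count range over the same `Fin M`
    -- as `count-smooth`.
    count-split = count-colourings (points G ↔-∘ placed) k (circles H)
      (λ i → proper? (underlyingGraph H) (finToFun {k} {vertices H} i)) (Splits? A)
      (λ {i} {j} eq → mk⇔ (to eq) (from eq))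
      (λ {j} (on , split) → step-elim (λ x y → κ j (map₁ place x) ≡ κ j (map₁ place y)) refl
        ( (λ x → trans (onArcs⇒ {j} on (place x)) (cong (h j) (sym (place-unplace (arc G (place x))))))
        ∷ (λ { (e , a , tail) → proj₁ (new split e) a
             ; (e , a , tip)  → sym (proj₁ (new split e) a) })
        ∷ []))
      where
      col : Fin (k ℕ.^ vertices H) → Point H → Fin k
      col i x = finToFun {k} {vertices H} i (Classes.class (circles H) x)

      new : ∀ {j} → (∀ e → Split (h j) e (lookup A e)) → ∀ e → _
      new {j} split e = Equivalence.to (split-new (h j) e (lookup A e)) (split e)

      module _ {i : Fin (k ℕ.^ vertices H)} {j : Fin M} (eq : ∀ x → col i x ≡ κ j (map₁ place x)) where

        constant : ∀ {m} → m ∈ arc H ∷ along ∷ [] → ∀ x → h j (place x) ≡ h j (place (m x))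
        constant m∈ x = trans (sym (eq _))
          (trans (cong (finToFun {k} {vertices H} i) (move (circles H) m∈ x)) (eq _))

        to : Proper (underlyingGraph H) (finToFun {k} {vertices H} i) →
             OnArcs j × ∀ e → Split (h j) e (lookup A e)
        to proper =
          onArcs⇐ (λ x → begin
            h j x                               ≡⟨ cong (h j) (place-unplace x) ⟨
            h j (place (unplace x))             ≡⟨ constant (here refl) (unplace x) ⟩
            h j (place (arc H (unplace x)))     ≡⟨ cong (h j) (place-unplace _) ⟩
            h j (arc G (place (unplace x)))     ≡⟨ cong (h j ∘ arc G) (place-unplace x) ⟩
            h j (arc G x)                       ∎) ,
          λ e → Equivalence.from (split-new (h j) e (lookup A e))
            ( (λ a → constant (there (here refl)) (e , a , tail))
            , λ α≡β → proper e (trans (eq _) (trans α≡β (sym (eq _)))))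
          where open ≡-Reasoning

        from : OnArcs j × (∀ e → Split (h j) e (lookup A e)) →
               Proper (underlyingGraph H) (finToFun {k} {vertices H} i)
        from (_ , split) e α≡β = proj₂ (new {j} split e) (trans (sym (eq _)) (trans α≡β (eq _)))

  signed-counts :
    ∑±ℤ (edges G) (λ A → + (k ℕ.^ f G A)) ≡
    ∑±ℤ (edges G) (λ A → + properColourings (underlyingGraph (petrieDual (partialDual G A))) k)
  signed-counts = begin
    ∑±ℤ m (λ A → + (k ℕ.^ f G A))
      ≡⟨ ∑±ℤ-cong m (λ A → cong +_ (count-smooth A)) ⟩
    ∑±ℤ m (λ A → + length (filter (Smooths? A) (allFin M)))
      ≡⟨ ∑±ℤ-length-filter m Smooths? Splits? local (allFin M) ⟩
    ∑±ℤ m (λ A → + length (filter (Splits? A) (allFin M)))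
      ≡⟨ ∑±ℤ-cong m (λ A → cong +_ (count-split A)) ⟨
    ∑±ℤ m (λ A → + properColourings (underlyingGraph (petrieDual (partialDual G A))) k) ∎
    where
    open ≡-Reasoning
    m = edges G
    local : ∀ j → ∑±ℤ m (λ A → ind (Smooths? A j)) ≡ ∑±ℤ m (λ A → ind (Splits? A j))
    local j = begin
      ∑±ℤ m (λ A → ind (Smooths? A j))
        ≡⟨ ∑±ℤ-local (OnArcs? j) m (λ e → Smooth? (h j) e Fin._≟_) ⟩
      _ ≡⟨ cong (ind (OnArcs? j) ℤ.*_) (∏-cong λ e → smooth-split (h j) e Fin._≟_) ⟩
      _ ≡⟨ ∑±ℤ-local (OnArcs? j) m (λ e → Split? (h j) e Fin._≟_) ⟨
      ∑±ℤ m (λ A → ind (Splits? A j)) ∎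

-- Both signed sums as integer polynomials

module _ (G : EmbeddedGraph) where
  private
    m = edges G

  χᴾ fᴾ : Polynomial
  χᴾ = ∑±ᴾ m λ A → proj₁ (chromaticPolynomial (underlyingGraph (petrieDual (partialDual G A))))
  fᴾ = ∑±ᴾ m λ A → X^ (f G A)

  vanishes-at-ℕ : ∀ k → evalℤ (fᴾ ⊖ χᴾ) (+ k) ≡ + 0
  vanishes-at-ℕ k = begin
    evalℤ (fᴾ ⊖ χᴾ) (+ k)                  ≡⟨ DeletionContraction.eval-⊖ fᴾ χᴾ (+ k) ⟩
    evalℤ fᴾ (+ k) ℤ.- evalℤ χᴾ (+ k)      ≡⟨ ℤ.i≡j⇒i-j≡0 same ⟩
    + 0                                    ∎
    where
    open ≡-Reasoning
    same : evalℤ fᴾ (+ k) ≡ evalℤ χᴾ (+ k)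
    same = begin
      evalℤ fᴾ (+ k)
        ≡⟨ evalℤ-∑±ᴾ m _ (+ k) ⟩
      ∑±ℤ m (λ A → evalℤ (X^ (f G A)) (+ k))
        ≡⟨ ∑±ℤ-cong m (λ A → DeletionContraction.eval-X^ (f G A) k) ⟩
      ∑±ℤ m (λ A → + (k ℕ.^ f G A))
        ≡⟨ signed-counts G k ⟩
      ∑±ℤ m (λ A → + properColourings (underlyingGraph (petrieDual (partialDual G A))) k)
        ≡⟨ ∑±ℤ-cong m (λ A → proj₂ (chromaticPolynomial (underlyingGraph (petrieDual (partialDual G A)))) k) ⟨
      ∑±ℤ m (λ A → evalℤ (proj₁ (chromaticPolynomial (underlyingGraph (petrieDual (partialDual G A))))) (+ k))
        ≡⟨ evalℤ-∑±ᴾ m _ (+ k) ⟨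
      evalℤ χᴾ (+ k) ∎

-- The two identities in an arbitrary commutative ring

module Theorem {a ℓ} (K : CommutativeRing a ℓ) (G : EmbeddedGraph) where
  open CommutativeRing K
    renaming (refl to ≈-refl; sym to ≈-sym; trans to ≈-trans)
  open Exp semiring using (_^_; ^-congˡ; ^-congʳ; ^-homo-*)
  open CommExp commutativeSemiring using (^-distrib-*)
  open Evaluation K
  open GraphPolynomials K
  open SignedSums K
  open RingProperties ring using (-1*x≈-x)
  open AbelianGroupProperties +-abelianGroup using (⁻¹-involutive; x∙y⁻¹≈ε⇒x≈y; ⁻¹-anti-homo‿-; xyx⁻¹≈y)
  open CommutativeSemigroupProperties *-commutativeSemigroup using (interchange)
  open import Relation.Binary.Reasoning.Setoid setoid

  private
    m = edges G

  -- The difference of the two integer polynomials has only zero coefficients, so it vanishes at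
  -- every `l`, even if `K` has zero divisors or positive characteristic.
  signed-boundaries : ∀ l →
    ∑⊆ m (λ A → (- 1#) ^ ∣ A ∣ * l ^ f G A) ≈
    ∑⊆ m (λ A → (- 1#) ^ ∣ A ∣ * χ (petrieDual (partialDual G A)) l)
  signed-boundaries l = begin
    ∑⊆ m (λ A → (- 1#) ^ ∣ A ∣ * l ^ f G A)      ≈⟨ ∑⊆-signed m _ ⟩
    ∑± m (λ A → l ^ f G A)                       ≈⟨ ∑±-cong m (λ A → eval-X^ (f G A) l) ⟨
    ∑± m (λ A → eval (X^ (f G A)) l)             ≈⟨ eval-∑±ᴾ m _ l ⟨
    eval (fᴾ G) l
      ≈⟨ x∙y⁻¹≈ε⇒x≈y _ _ (≈-trans (≈-sym (eval-⊖ (fᴾ G) (χᴾ G) l))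
      (eval-zero (vanishing⇒zero (fᴾ G ⊖ χᴾ G) (vanishes-at-ℕ G ∘ suc)) l)) ⟩
    eval (χᴾ G) l                                    ≈⟨ eval-∑±ᴾ m _ l ⟩
    ∑± m (λ A → χ (petrieDual (partialDual G A)) l)   ≈⟨ ∑⊆-signed m _ ⟨
    ∑⊆ m (λ A → (- 1#) ^ ∣ A ∣ * χ (petrieDual (partialDual G A)) l) ∎

  neg-^ : ∀ x d → (- x) ^ d ≈ (- 1#) ^ d * x ^ d
  neg-^ x d = ≈-trans (^-congˡ d (≈-sym (-1*x≈-x x))) (^-distrib-* (- 1#) x d)

  sign-even : ∀ d → (- 1#) ^ (d ℕ.+ d) ≈ 1#
  sign-even zero    = ≈-refl
  sign-even (suc d) = begin
    - 1# * (- 1#) ^ (d ℕ.+ suc d)       ≡⟨ cong (λ t → - 1# * (- 1#) ^ t) (ℕ.+-suc d d) ⟩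
    - 1# * (- 1# * (- 1#) ^ (d ℕ.+ d))  ≈⟨ ≈-trans (-1*x≈-x _) (-‿cong (-1*x≈-x _)) ⟩
    - - ((- 1#) ^ (d ℕ.+ d))            ≈⟨ ⁻¹-involutive _ ⟩
    (- 1#) ^ (d ℕ.+ d)                  ≈⟨ sign-even d ⟩
    1#                                  ∎

  -- With `d` the corank of `A`, the total exponent of `- 1#` is `r(G) + d + n(A) = 2d + |A|`, since
  -- `r(G) = d + r(A)`. That of `l` is `c(G) + d + n(A) = c(A) + n(A)`.
  term : ∀ {u w l} → u ≈ - l → w ≈ - l → ∀ A →
    (- 1#) ^ r G ⊤ * l ^ c G ⊤ * (u ^ (r G ⊤ ∸ r G A) * w ^ n G A) ≈
    (- 1#) ^ ∣ A ∣ * l ^ (c G A ℕ.+ n G A)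
  term {u} {w} {l} u≈ w≈ A = begin
    s ^ ρ * l ^ γ * (u ^ d * w ^ ν)
      ≈⟨ *-congˡ (*-cong (^-congˡ d u≈) (^-congˡ ν w≈)) ⟩
    s ^ ρ * l ^ γ * ((- l) ^ d * (- l) ^ ν)
      ≈⟨ *-congˡ (^-homo-* (- l) d ν) ⟨
    s ^ ρ * l ^ γ * (- l) ^ (d ℕ.+ ν)
      ≈⟨ *-congˡ (neg-^ l (d ℕ.+ ν)) ⟩
    s ^ ρ * l ^ γ * (s ^ (d ℕ.+ ν) * l ^ (d ℕ.+ ν))
      ≈⟨ interchange _ _ _ _ ⟩
    s ^ ρ * s ^ (d ℕ.+ ν) * (l ^ γ * l ^ (d ℕ.+ ν))
      ≈⟨ *-cong (^-homo-* s ρ (d ℕ.+ ν)) (^-homo-* l γ (d ℕ.+ ν)) ⟨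
    s ^ (ρ ℕ.+ (d ℕ.+ ν)) * l ^ (γ ℕ.+ (d ℕ.+ ν))
      ≡⟨ cong₂ (λ i j → s ^ i * l ^ j) signs powers ⟩
    s ^ (d ℕ.+ d ℕ.+ ∣ A ∣) * l ^ (c G A ℕ.+ ν)
      ≈⟨ *-congʳ (≈-trans (^-homo-* s (d ℕ.+ d) ∣ A ∣) (≈-trans (*-congʳ (sign-even d)) (*-identityˡ _))) ⟩
    s ^ ∣ A ∣ * l ^ (c G A ℕ.+ ν) ∎
    where
    s = - 1#
    ρ = r G ⊤
    γ = c G ⊤
    ν = n G A
    d = ρ ∸ r G A
    signs : ρ ℕ.+ (d ℕ.+ ν) ≡ d ℕ.+ d ℕ.+ ∣ A ∣
    signs = trans (cong (ℕ._+ (d ℕ.+ ν)) (sym (ℕ.m∸n+n≡m (r≤r-full G A))))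
      (trans (solve 3 (λ d r ν → d :+ r :+ (d :+ ν) := d :+ d :+ (r :+ ν)) refl d (r G A) ν)
        (cong (d ℕ.+ d ℕ.+_) (r+n G A)))
      where open +-*-Solver using (solve; _:=_; _:+_)
    powers : γ ℕ.+ (d ℕ.+ ν) ≡ c G A ℕ.+ ν
    powers = trans (sym (ℕ.+-assoc γ d ν)) (cong (ℕ._+ ν) (c-corank G A))

  inverse-^ : ∀ {l l⁻¹} → l * l⁻¹ ≈ 1# → ∀ d → l ^ d * l⁻¹ ^ d ≈ 1#
  inverse-^ {l} {l⁻¹} inv zero    = *-identityˡ 1#
  inverse-^ {l} {l⁻¹} inv (suc d) = ≈-trans (interchange l (l ^ d) l⁻¹ (l⁻¹ ^ d))
    (≈-trans (*-cong inv (inverse-^ inv d)) (*-identityˡ 1#))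

  -- The inverse `l⁻¹` renders `1/λ`; taking Laurent polynomials over the integers for `K` gives the
  -- identity with λ an indeterminate.
  part₁ : ∀ l l⁻¹ → l * l⁻¹ ≈ 1# →
    (- 1#) ^ r G ⊤ * l ^ c G ⊤ * R G (1# - l) (- l) l⁻¹ ≈
    ∑⊆ m (λ A → (- 1#) ^ ∣ A ∣ * χ (petrieDual (partialDual G A)) l)
  part₁ l l⁻¹ inv = begin
    (- 1#) ^ r G ⊤ * l ^ c G ⊤ * R G (1# - l) (- l) l⁻¹
      ≈⟨ ∑⊆-*ˡ m _ _ ⟨
    ∑⊆ m (λ A → (- 1#) ^ r G ⊤ * l ^ c G ⊤ *
      (((1# - l) - 1#) ^ (r G ⊤ ∸ r G A) * (- l) ^ n G A * l⁻¹ ^ excess A))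
      ≈⟨ ∑⊆-cong m (λ A → ≈-trans (≈-sym (*-assoc _ _ _))
           (≈-trans (*-congʳ (term (xyx⁻¹≈y 1# (- l)) ≈-refl A)) (≈-trans (*-assoc _ _ _) (*-congˡ (cancel A))))) ⟩
    ∑⊆ m (λ A → (- 1#) ^ ∣ A ∣ * l ^ f G A)
      ≈⟨ signed-boundaries l ⟩
    _ ∎
    where
    excess : Subset m → ℕ
    excess A = (c G A ℕ.+ n G A) ∸ f G A
    -- Non-negativity of the Euler genus enters here: `excess A` does not truncate, so the powers of
    -- `l⁻¹` cancel `l ^ (c G A ℕ.+ n G A)` down to `l ^ f G A`.
    cancel : ∀ A → l ^ (c G A ℕ.+ n G A) * l⁻¹ ^ excess A ≈ l ^ f G A
    cancel A = begin
      l ^ (c G A ℕ.+ n G A) * l⁻¹ ^ excess A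
        ≡⟨ cong (λ t → l ^ t * l⁻¹ ^ excess A) (ℕ.m+[n∸m]≡n (f≤c+n G A)) ⟨
      l ^ (f G A ℕ.+ excess A) * l⁻¹ ^ excess A       ≈⟨ *-congʳ (^-homo-* l (f G A) (excess A)) ⟩
      l ^ f G A * l ^ excess A * l⁻¹ ^ excess A       ≈⟨ *-assoc _ _ _ ⟩
      l ^ f G A * (l ^ excess A * l⁻¹ ^ excess A)     ≈⟨ *-congˡ (inverse-^ inv (excess A)) ⟩
      l ^ f G A * 1#                                  ≈⟨ *-identityʳ _ ⟩
      l ^ f G A                                       ∎

  -- Both bases in `T G x x` are `x - 1#`, the negative of `1# - x`, so `term` applies to each
  -- summand; planarity turns its exponent into `f G A`.
  part₂ : Plane G → ∀ x →
    (- 1#) ^ r G ⊤ * (1# - x) ^ c G ⊤ * T G x x ≈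
    ∑⊆ m (λ A → (- 1#) ^ ∣ A ∣ * χ (petrieDual (partialDual G A)) (1# - x))
  part₂ plane x = begin
    (- 1#) ^ r G ⊤ * (1# - x) ^ c G ⊤ * T G x x
      ≈⟨ ∑⊆-*ˡ m _ _ ⟨
    ∑⊆ m (λ A → (- 1#) ^ r G ⊤ * (1# - x) ^ c G ⊤ *
      ((x - 1#) ^ (r G ⊤ ∸ r G A) * (x - 1#) ^ n G A))
      ≈⟨ ∑⊆-cong m (λ A → ≈-trans (term flip flip A)
           (*-congˡ (^-congʳ (1# - x) (sym (plane⇒f≡c+n G A plane))))) ⟩
    ∑⊆ m (λ A → (- 1#) ^ ∣ A ∣ * (1# - x) ^ f G A)
      ≈⟨ signed-boundaries (1# - x) ⟩
    _ ∎
    where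
    flip : x - 1# ≈ - (1# - x)
    flip = ≈-sym (⁻¹-anti-homo‿- 1# x)

corollary5p5 : ∀ {a ℓ} (K : CommutativeRing a ℓ) (G : EmbeddedGraph) →
    let open CommutativeRing K
        open Exp semiring using (_^_)
        open Evaluation K using (∑⊆)
        open GraphPolynomials K
    in
      (∀ l l⁻¹ → l * l⁻¹ ≈ 1# →
         (- 1#) ^ r G ⊤ * l ^ c G ⊤ * R G (1# - l) (- l) l⁻¹
           ≈ ∑⊆ (edges G) λ A → (- 1#) ^ ∣ A ∣ * χ (petrieDual (partialDual G A)) l)
      ×
      (Plane G → ∀ x →
         (- 1#) ^ r G ⊤ * (1# - x) ^ c G ⊤ * T G x x
           ≈ ∑⊆ (edges G) λ A → (- 1#) ^ ∣ A ∣ * χ (petrieDual (partialDual G A)) (1# - x))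
corollary5p5 K G = Theorem.part₁ K G , Theorem.part₂ K G
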